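{- There is a polynomial-time algorithm that, given an instance $(G,k)$ of \textsc{Vertex Cover}, outputs an equivalent instance $(G',k')$ with $k'\le k$ such that (I) every vertex of $G'$ has degree at least four in $G'$, and (II) for every vertex $v\in V(G')$ with $\deg_{G'}(v)=4$, the subgraph $G'[N_{G'}(v)]$ induced by its neighborhood contains at most two edges.
   Context: \textsc{Vertex Cover}: given a finite simple undirected graph $G$ and an integer $k$, decide whether $G$ has a vertex cover (a set of vertices containing at least one endpoint of every edge) of size at most $k$. Two instances are equivalent if both are yes-instances or both are no-instances. -}

module Defs where

open import Data.Bool using (Bool; true; false; T)
open import Data.Bool.Properties using (T?)
open import Data.Fin using (Fin; zero)
open import Data.Fin.Properties using (_<?_)
open import Data.Fin.Subset using (Subset; _∈_; ∣_∣)
open import Data.Fin.Subset.Properties using (_∈?_)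
open import Data.Integer as ℤ using (ℤ; +_; -[1+_])
open import Data.List using (List; []; _∷_; length; lookup; filter; allFin; cartesianProduct; tabulate)
open import Data.Nat using (ℕ; suc; _+_; _*_; _^_; _≤_)
open import Data.Nat.Binary using (ℕᵇ; zero; 2[1+_]; 1+[2_]; fromℕ)
open import Data.Product using (∃-syntax; _×_; _,_)
open import Data.Sum using (_⊎_)
import Data.Vec as Vec
open Vec using (Vec; _∷_; _[_]≔_)
open import Relation.Binary.PropositionalEquality using (_≡_; _≢_)
open import Relation.Nullary using (¬_)
open import Relation.Nullary.Decidable using (_×-dec_)

record Graph : Set where
  field
    order  : ℕ
    adj    : Fin order → Fin order → Bool
    symm   : ∀ u v → adj u v ≡ adj v u
    irrefl : ∀ v → adj v v ≡ false

open Graph public using (order; adj)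

V : Graph → Set
V G = Fin (order G)

Adj : (G : Graph) → V G → V G → Set
Adj G u v = T (adj G u v)

neighbourhood : (G : Graph) → V G → Subset (order G)
neighbourhood G v = Vec.tabulate (adj G v)

degree : (G : Graph) → V G → ℕ
degree G v = ∣ neighbourhood G v ∣

-- An undirected edge is listed once, smaller endpoint first.
edges : (G : Graph) → List (V G × V G)
edges G = filter (λ (u , v) → (u <? v) ×-dec T? (adj G u v))
                 (cartesianProduct (allFin (order G)) (allFin (order G)))

elements : ∀ {m} → Subset m → List (Fin m)
elements {m} S = filter (_∈? S) (allFin m)

-- Vertex i of the induced subgraph is the i-th element of S.
inducedSubgraph : (G : Graph) → Subset (order G) → Graph
inducedSubgraph G S = record
  { order  = length (elements S)
  ; adj    = λ i j → adj G (lookup (elements S) i) (lookup (elements S) j)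
  ; symm   = λ i j → Graph.symm G (lookup (elements S) i) (lookup (elements S) j)
  ; irrefl = λ i → Graph.irrefl G (lookup (elements S) i)
  }

IsVertexCover : (G : Graph) → Subset (order G) → Set
IsVertexCover G S = ∀ u v → Adj G u v → u ∈ S ⊎ v ∈ S

record Instance : Set where
  constructor ⟨_,_⟩
  field
    graph  : Graph
    budget : ℤ

open Instance public

YesInstance : Instance → Set
YesInstance ⟨ G , k ⟩ = ∃[ S ] IsVertexCover G S × + ∣ S ∣ ℤ.≤ k

Equivalent : Instance → Instance → Set
Equivalent I J = (YesInstance I × YesInstance J) ⊎ (¬ YesInstance I × ¬ YesInstance J)

-- The model of computation: the WHILE language over binary trees
-- (N. D. Jones, "Computability and Complexity from a Programming
-- Perspective"), without its tree-equality test and with a primitive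
-- conditional.  All primitive operations act on the roots of trees, so
-- they are constant-time pointer operations and are charged unit cost.

data Tree : Set where
  nil  : Tree
  cons : Tree → Tree → Tree

size : Tree → ℕ
size nil        = 1
size (cons s t) = suc (size s + size t)

head : Tree → Tree
head nil        = nil
head (cons s t) = s

tail : Tree → Tree
tail nil        = nil
tail (cons s t) = t

data Expr (m : ℕ) : Set where
  var  : Fin m → Expr m
  nil  : Expr m
  cons : Expr m → Expr m → Expr m
  hd   : Expr m → Expr m
  tl   : Expr m → Expr m

infix  6 _≔_
infixr 5 _⨾_

data Command (m : ℕ) : Set where
  _≔_           : Fin m → Expr m → Command m
  _⨾_           : Command m → Command m → Command m
  if_then_else_ : Expr m → Command m → Command m → Command m
  while_loop_   : Expr m → Command m → Command m

Store : ℕ → Set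
Store m = Vec Tree m

eval : ∀ {m} → Expr m → Store m → Tree
eval (var x)    σ = Vec.lookup σ x
eval nil        σ = nil
eval (cons d e) σ = cons (eval d σ) (eval e σ)
eval (hd e)     σ = head (eval e σ)
eval (tl e)     σ = tail (eval e σ)

exprCost : ∀ {m} → Expr m → ℕ
exprCost (var x)    = 1
exprCost nil        = 1
exprCost (cons d e) = suc (exprCost d + exprCost e)
exprCost (hd e)     = suc (exprCost e)
exprCost (tl e)     = suc (exprCost e)

-- ⟨ c ∣ σ ⟩⇓[ t ] τ : started in store σ, command c halts in store τ
-- after t steps.  Guards hold when they are not nil.
infix 4 ⟨_∣_⟩⇓[_]_

data ⟨_∣_⟩⇓[_]_ {m : ℕ} : Command m → Store m → ℕ → Store m → Set where

  assign : ∀ {x e σ} →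
    ⟨ x ≔ e ∣ σ ⟩⇓[ suc (exprCost e) ] (σ [ x ]≔ eval e σ)

  seq : ∀ {c d σ τ υ s t} →
    ⟨ c ∣ σ ⟩⇓[ s ] τ →
    ⟨ d ∣ τ ⟩⇓[ t ] υ →
    ⟨ c ⨾ d ∣ σ ⟩⇓[ s + t ] υ

  if-true : ∀ {e c d σ τ t} →
    eval e σ ≢ nil →
    ⟨ c ∣ σ ⟩⇓[ t ] τ →
    ⟨ if e then c else d ∣ σ ⟩⇓[ suc (exprCost e + t) ] τ

  if-false : ∀ {e c d σ τ t} →
    eval e σ ≡ nil →
    ⟨ d ∣ σ ⟩⇓[ t ] τ →
    ⟨ if e then c else d ∣ σ ⟩⇓[ suc (exprCost e + t) ] τ

  while-true : ∀ {e c σ τ υ s t} →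
    eval e σ ≢ nil →
    ⟨ c ∣ σ ⟩⇓[ s ] τ →
    ⟨ while e loop c ∣ τ ⟩⇓[ t ] υ →
    ⟨ while e loop c ∣ σ ⟩⇓[ suc (exprCost e + (s + t)) ] υ

  while-false : ∀ {e c σ} →
    eval e σ ≡ nil →
    ⟨ while e loop c ∣ σ ⟩⇓[ suc (exprCost e) ] σ

-- A program uses finitely many variables; the first one holds the input
-- and the output, all others are initially nil.
record Program : Set where
  field
    locals : ℕ
    body   : Command (suc locals)

-- Besides the steps of the computation, writing the output in full is
-- charged for: a tree built with sharing may be exponentially larger than
-- the number of steps that built it.
RunsInTime : Program → Tree → Tree → ℕ → Set
RunsInTime P input output time =
  ∃[ t ] ∃[ τ ]
    ⟨ Program.body P ∣ input ∷ Vec.replicate (Program.locals P) nil ⟩⇓[ t ] τ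
    × Vec.lookup τ zero ≡ output
    × t + size output ≤ time

-- As sizes are positive, every polynomial in the input size is bounded by
-- one of the form a * size ^ b.
PolynomialTime : {A B : Set} → (A → Tree) → (B → Tree) → (A → B) → Set
PolynomialTime encodeIn encodeOut f =
  ∃[ P ] ∃[ a ] ∃[ b ] ∀ x →
    RunsInTime P (encodeIn x) (encodeOut (f x)) (a * size (encodeIn x) ^ b)

-- Instances are encoded by the adjacency matrix, as a list of rows, and the
-- budget as sign and magnitude, the magnitude being written in (bijective)
-- binary with the least significant digit first.

encodeBool : Bool → Tree
encodeBool false = nil
encodeBool true  = cons nil nil

encodeList : {A : Set} → (A → Tree) → List A → Tree
encodeList encode []       = nil
encodeList encode (x ∷ xs) = cons (encode x) (encodeList encode xs)

encodeℕᵇ : ℕᵇ → Tree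
encodeℕᵇ zero     = nil
encodeℕᵇ 2[1+ x ] = cons (encodeBool true) (encodeℕᵇ x)
encodeℕᵇ 1+[2 x ] = cons (encodeBool false) (encodeℕᵇ x)

-- The magnitude of -[1+ i ] is stored as i, so that zero has one code.
encodeℤ : ℤ → Tree
encodeℤ (+ i)    = cons (encodeBool false) (encodeℕᵇ (fromℕ i))
encodeℤ -[1+ i ] = cons (encodeBool true) (encodeℕᵇ (fromℕ i))

encodeGraph : Graph → Tree
encodeGraph G = encodeList (encodeList encodeBool) (tabulate (λ u → tabulate (adj G u)))

encodeInstance : Instance → Tree
encodeInstance ⟨ G , k ⟩ = cons (encodeGraph G) (encodeℤ k)

-- A single rule does all the work, the struction: if v has p neighbours with q ≤ p non-adjacent pairs
-- among them, replace v and its neighbours by these pairs.  Pairs with different first components are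
-- joined; otherwise two new vertices are joined when some edge runs between their components, and a pair
-- is joined to an old vertex in the same case.  The independence number drops by exactly one, so the
-- cover number drops by p − q while the graph loses p + 1 − q ≥ 1 vertices; hence the rule applies at
-- most as often as there are vertices.  Once it is exhausted, each neighbourhood has more non-adjacent
-- pairs than vertices.  As p vertices form p (p − 1) / 2 pairs, this forces p ≥ 4, and for p = 4 at least
-- five of the six pairs are non-adjacent.
--
-- For the running time, functions on lists, numbers and booleans are compiled to programs that come
-- with polynomial bounds on their time and on the size of their values.  Such functions are closed under
-- composition, pairing, branching and primitive recursion on lists with polynomially bounded values.

module Submission where

open import Defs
open import Data.Bool using (Bool; true; false; not; _∧_; _∨_; T) renaming (if_then_else_ to when_then_else_)
open import Data.Bool.Properties using (T?)
open import Data.Empty using (⊥-elim)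
open import Data.Fin using (Fin; zero; suc; toℕ)
open import Data.Fin.Properties as Fin using (toℕ-injective)
open import Data.Fin.Subset using (Subset; ∣_∣) renaming (_∈_ to _∈ₛ_)
open import Data.Fin.Subset.Properties using (_∈?_; anySubset?)
open import Data.Integer using (ℤ; -[1+_]; +≤+; -≤+) renaming (_≤_ to _≤ℤ_; +_ to ⁺_)
import Data.Integer.Properties as ℤ
open import Data.List using (List; []; _∷_; _++_; length; map; filterᵇ; reverse; _ʳ++_; upTo; applyUpTo; replicate; drop; tabulate; lookup; allFin; cartesianProduct; filter)
open import Data.List.Membership.Propositional using (_∈_; find; lose)
open import Data.List.Membership.Propositional.Properties using (∈-++⁻; ∈-map⁻; ∈-filter⁻; ∈-filter⁺; ∈-lookup; ∈-tabulate⁺)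
open import Data.List.Properties using (reverse-involutive; length-reverse; length-++; length-map; length-upTo; length-tabulate; map-tabulate; tabulate-lookup; tabulate-cong; filter-≐; upTo-∷ʳ)
open import Data.List.Relation.Unary.All as All using (All; []; _∷_)
open import Data.List.Relation.Unary.AllPairs using ([]; _∷_)
open import Data.List.Relation.Unary.Any using (here; there; any?)
open import Data.List.Relation.Unary.Unique.Propositional using (Unique)
import Data.List.Relation.Unary.Unique.Propositional.Properties as Unique
open import Data.Nat using (ℕ; zero; suc; _+_; _*_; _^_; _∸_; pred; _≤_; _<_; _≡ᵇ_; z≤n; s≤s)
import Data.Nat.Binary as Bin
open Bin using (ℕᵇ; 2[1+_]; 1+[2_]; fromℕ)
open import Data.Nat.Binary.Properties using (fromℕ-pred) renaming (toℕ-fromℕ to toℕᵇ-fromℕ)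
open import Data.Nat.GeneralisedArithmetic using (fold)
open import Data.Nat.Properties
open import Data.Nat.Solver using (module +-*-Solver)
open +-*-Solver using (solve; _:=_; _:+_) renaming (con to con′)
open import Data.Product using (∃-syntax; _×_; _,_; proj₁; proj₂)
open import Data.Product.Properties using (≡-dec)
open import Data.Sum using (_⊎_; inj₁; inj₂)
import Data.Vec as Vec
open Vec using ([]; _∷_; _[_]≔_; here; there)
import Data.Vec.Properties as Vec
open import Function using (case_of_)
open import Relation.Binary.PropositionalEquality using (_≡_; _≢_; refl; sym; trans; cong; cong₂; subst; subst₂; module ≡-Reasoning)
open import Relation.Nullary using (¬_; Dec; yes; no; does; contradiction)
open import Relation.Nullary.Decidable using (⌊_⌋; toWitness; fromWitness; ¬?; _×-dec_; _⊎-dec_; _→-dec_)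

-- Polynomially bounded functions

-- The independence number drops by one whatever `p` and `q` are; the condition `q ≤ p` keeps the
-- budget from rising and the graph from growing. The combinatorial core therefore speaks of
-- independent sets. Covers enter by complementation, where the change in the number of vertices
-- turns the one into `p − q`. Familiar rules are special cases: `q = 0` puts all neighbours of a
-- simplicial vertex into the cover, and `p = 2`, `q = 1` folds a vertex of degree two. The obstacle
-- for the running time is that iterating a polynomial-time step linearly often need not take
-- polynomial time. Here the number of vertices never grows and the weight of a square Boolean
-- matrix is fixed by its dimension, so one polynomial bounds all intermediate states. In the core,
-- vertices are natural numbers and edges are read off a matrix, so that the compiled functions and
-- the graphs share their definitions. The vertices of a new graph are the positions in the list of
-- labels.

infixl 6 _⊕_
infixl 7 _⊛_
infixr 8 _⊚_

-- Natural coefficients make every expression monotone, and composition is a constructor, so bounds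
-- for composed programs need no expansion. Only `monomial` brings them into the shape that
-- `PolynomialTime` asks for.
data Poly : Set where
  con : ℕ → Poly
  arg : Poly
  _⊕_ _⊛_ _⊚_ : Poly → Poly → Poly

⟪_⟫ : Poly → ℕ → ℕ
⟪ con k ⟫ n = k
⟪ arg ⟫ n = n
⟪ P ⊕ Q ⟫ n = ⟪ P ⟫ n + ⟪ Q ⟫ n
⟪ P ⊛ Q ⟫ n = ⟪ P ⟫ n * ⟪ Q ⟫ n
⟪ P ⊚ Q ⟫ n = ⟪ P ⟫ (⟪ Q ⟫ n)

⟪⟫-mono : ∀ P {m n} → m ≤ n → ⟪ P ⟫ m ≤ ⟪ P ⟫ n
⟪⟫-mono (con k) m≤n = ≤-refl
⟪⟫-mono arg m≤n = m≤n
⟪⟫-mono (P ⊕ Q) m≤n = +-mono-≤ (⟪⟫-mono P m≤n) (⟪⟫-mono Q m≤n)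
⟪⟫-mono (P ⊛ Q) m≤n = *-mono-≤ (⟪⟫-mono P m≤n) (⟪⟫-mono Q m≤n)
⟪⟫-mono (P ⊚ Q) m≤n = ⟪⟫-mono P (⟪⟫-mono Q m≤n)

-- The coefficient is positive so that an inner monomial is a legitimate argument of an outer one.
monomial : ∀ P → ∃[ a ] ∃[ b ] 1 ≤ a × (∀ n → 1 ≤ n → ⟪ P ⟫ n ≤ a * n ^ b)
monomial (con k) = suc k , 0 , s≤s z≤n , λ n _ → ≤-trans (n≤1+n k) (≤-reflexive (sym (*-identityʳ (suc k))))
monomial arg = 1 , 1 , s≤s z≤n , λ n _ → ≤-reflexive (sym (trans (+-identityʳ _) (*-identityʳ n)))
monomial (P ⊕ Q) with monomial P | monomial Q
... | a , b , 1≤a , p | c , d , 1≤c , q = a + c , b + d , ≤-trans 1≤a (m≤m+n a c) , bound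
  where
  open ≤-Reasoning
  bound : ∀ n → 1 ≤ n → ⟪ P ⊕ Q ⟫ n ≤ (a + c) * n ^ (b + d)
  bound n@(suc _) 1≤n = begin
    ⟪ P ⟫ n + ⟪ Q ⟫ n               ≤⟨ +-mono-≤ (p n 1≤n) (q n 1≤n) ⟩
    a * n ^ b + c * n ^ d           ≤⟨ +-mono-≤ (*-monoʳ-≤ a (^-monoʳ-≤ n (m≤m+n b d))) (*-monoʳ-≤ c (^-monoʳ-≤ n (m≤n+m d b))) ⟩
    a * n ^ (b + d) + c * n ^ (b + d) ≡⟨ *-distribʳ-+ (n ^ (b + d)) a c ⟨
    (a + c) * n ^ (b + d)           ∎
monomial (P ⊛ Q) with monomial P | monomial Q
... | a , b , 1≤a , p | c , d , 1≤c , q = a * c , b + d , *-mono-≤ 1≤a 1≤c , bound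
  where
  open ≤-Reasoning
  bound : ∀ n → 1 ≤ n → ⟪ P ⊛ Q ⟫ n ≤ a * c * n ^ (b + d)
  bound n 1≤n = begin
    ⟪ P ⟫ n * ⟪ Q ⟫ n           ≤⟨ *-mono-≤ (p n 1≤n) (q n 1≤n) ⟩
    a * n ^ b * (c * n ^ d)     ≡⟨ [m*n]*[o*p]≡[m*o]*[n*p] a (n ^ b) c (n ^ d) ⟩
    a * c * (n ^ b * n ^ d)     ≡⟨ cong (a * c *_) (^-distribˡ-+-* n b d) ⟨
    a * c * n ^ (b + d)         ∎
monomial (P ⊚ Q) with monomial P | monomial Q
... | a , b , 1≤a , p | c , d , 1≤c , q = a * c ^ b , d * b , *-mono-≤ 1≤a (1≤^ c b 1≤c) , bound
  where
  open ≤-Reasoning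
  ^-distrib-* : ∀ m n k → (m * n) ^ k ≡ m ^ k * n ^ k
  ^-distrib-* m n zero = refl
  ^-distrib-* m n (suc k) = trans (cong (m * n *_) (^-distrib-* m n k)) ([m*n]*[o*p]≡[m*o]*[n*p] m n (m ^ k) (n ^ k))
  1≤^ : ∀ m k → 1 ≤ m → 1 ≤ m ^ k
  1≤^ m zero 1≤m = s≤s z≤n
  1≤^ m (suc k) 1≤m = *-mono-≤ 1≤m (1≤^ m k 1≤m)
  bound : ∀ n → 1 ≤ n → ⟪ P ⊚ Q ⟫ n ≤ a * c ^ b * n ^ (d * b)
  bound n 1≤n = begin
    ⟪ P ⟫ (⟪ Q ⟫ n)             ≤⟨ ⟪⟫-mono P (q n 1≤n) ⟩
    ⟪ P ⟫ (c * n ^ d)           ≤⟨ p (c * n ^ d) (*-mono-≤ 1≤c (1≤^ n d 1≤n)) ⟩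
    a * (c * n ^ d) ^ b         ≡⟨ cong (a *_) (^-distrib-* c (n ^ d) b) ⟩
    a * (c ^ b * (n ^ d) ^ b)   ≡⟨ *-assoc a (c ^ b) _ ⟨
    a * c ^ b * (n ^ d) ^ b     ≡⟨ cong (a * c ^ b *_) (^-*-assoc n d b) ⟩
    a * c ^ b * n ^ (d * b)     ∎

-- Data types and their codes

infixr 5 _⊗_

data Ty : Set where
  bool nat : Ty
  list : Ty → Ty
  _⊗_ : Ty → Ty → Ty

⟦_⟧ : Ty → Set
⟦ bool ⟧ = Bool
⟦ nat ⟧ = ℕ
⟦ list A ⟧ = List ⟦ A ⟧
⟦ A ⊗ B ⟧ = ⟦ A ⟧ × ⟦ B ⟧

code : ∀ {A} → ⟦ A ⟧ → Tree
code {bool} b = encodeBool b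
code {nat} zero = nil
code {nat} (suc n) = cons nil (code {nat} n)
code {list A} xs = encodeList (code {A}) xs
code {A ⊗ B} (x , y) = cons (code {A} x) (code {B} y)

-- Both truth values weigh the same, so that the weight of a matrix depends on its dimensions only.
weight : ∀ {A} → ⟦ A ⟧ → ℕ
weight {bool} b = 3
weight {nat} zero = 1
weight {nat} (suc n) = 2 + weight {nat} n
weight {list A} [] = 1
weight {list A} (x ∷ xs) = suc (weight {A} x + weight {list A} xs)
weight {A ⊗ B} (x , y) = suc (weight {A} x + weight {B} y)

1≤weight : ∀ {A} (x : ⟦ A ⟧) → 1 ≤ weight {A} x
1≤weight {bool} b = s≤s z≤n
1≤weight {nat} zero = s≤s z≤n
1≤weight {nat} (suc n) = s≤s z≤n
1≤weight {list A} [] = s≤s z≤n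
1≤weight {list A} (x ∷ xs) = s≤s z≤n
1≤weight {A ⊗ B} (x , y) = s≤s z≤n

size≤weight : ∀ {A} (x : ⟦ A ⟧) → size (code {A} x) ≤ weight {A} x
size≤weight {bool} false = s≤s z≤n
size≤weight {bool} true = ≤-refl
size≤weight {nat} zero = ≤-refl
size≤weight {nat} (suc n) = s≤s (s≤s (size≤weight {nat} n))
size≤weight {list A} [] = ≤-refl
size≤weight {list A} (x ∷ xs) = s≤s (+-mono-≤ (size≤weight {A} x) (size≤weight {list A} xs))
size≤weight {A ⊗ B} (x , y) = s≤s (+-mono-≤ (size≤weight {A} x) (size≤weight {B} y))

-- The factor is dictated by `false`, whose code has size 1 and whose weight is 3.
weight≤3*size : ∀ {A} (x : ⟦ A ⟧) → weight {A} x ≤ 3 * size (code {A} x)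
weight≤3*size {A} x = go {A} x
  where
  cons-≤ : ∀ {m n} s t → m ≤ 3 * s → n ≤ 3 * t → suc (m + n) ≤ 3 * suc (s + t)
  cons-≤ {m} {n} s t m≤ n≤ = begin
    suc (m + n)               ≤⟨ s≤s (+-mono-≤ m≤ n≤) ⟩
    suc (3 * s + 3 * t)       ≡⟨ cong suc (*-distribˡ-+ 3 s t) ⟨
    1 + 3 * (s + t)           ≤⟨ +-monoˡ-≤ _ {1} {3} (s≤s z≤n) ⟩
    3 + 3 * (s + t)           ≡⟨ *-suc 3 (s + t) ⟨
    3 * suc (s + t)           ∎
    where open ≤-Reasoning
  go : ∀ {A} (x : ⟦ A ⟧) → weight {A} x ≤ 3 * size (code {A} x)
  go {bool} false = ≤-refl
  go {bool} true = m≤m+n 3 6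
  go {nat} zero = s≤s z≤n
  go {nat} (suc n) = cons-≤ 1 (size (code {nat} n)) (s≤s z≤n) (go {nat} n)
  go {list A} [] = s≤s z≤n
  go {list A} (x ∷ xs) = cons-≤ (size (code {A} x)) (size (code {list A} xs)) (go {A} x) (go {list A} xs)
  go {A ⊗ B} (x , y) = cons-≤ (size (code {A} x)) (size (code {B} y)) (go {A} x) (go {B} y)

length≤weight : ∀ {A} (xs : ⟦ list A ⟧) → length xs ≤ weight {list A} xs
length≤weight [] = z≤n
length≤weight {A} (x ∷ xs) = s≤s (≤-trans (length≤weight {A} xs) (m≤n+m _ (weight {A} x)))

weight-ʳ++ : ∀ {A} (xs ys : ⟦ list A ⟧) → weight {list A} ys ≤ weight {list A} (xs ʳ++ ys)
weight-ʳ++ [] ys = ≤-refl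
weight-ʳ++ {A} (x ∷ xs) ys =
  ≤-trans (≤-trans (m≤n+m _ (weight {A} x)) (n≤1+n _)) (weight-ʳ++ {A} xs (x ∷ ys))

-- Two-variable programs with a running time

Run : ∀ {m} → Command m → Store m → Store m → ℕ → Set
Run c σ τ b = ∃[ t ] ⟨ c ∣ σ ⟩⇓[ t ] τ × t ≤ b

infixr 5 _▷_

_▷_ : ∀ {m} {c d : Command m} {σ τ υ a b} → Run c σ τ a → Run d τ υ b → Run (c ⨾ d) σ υ (a + b)
(s , p , s≤a) ▷ (t , q , t≤b) = s + t , seq p q , +-mono-≤ s≤a t≤b

assignment : ∀ {m} {x : Fin m} {e σ} → Run (x ≔ e) σ (σ [ x ]≔ eval e σ) (suc (exprCost e))
assignment = _ , assign , ≤-refl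

weaken : ∀ {m} {c : Command m} {σ τ a b} → a ≤ b → Run c σ τ a → Run c σ τ b
weaken a≤b (t , p , t≤a) = t , p , ≤-trans t≤a a≤b

-- Both branches are charged, so that the bound does not depend on the guard.
ifTrue : ∀ {m} {e} {c d : Command m} {σ τ a b} → eval e σ ≢ nil →
  Run c σ τ a → Run (if e then c else d) σ τ (suc (exprCost e + (a + b)))
ifTrue {e = e} ne (t , p , t≤a) = _ , if-true ne p , s≤s (+-monoʳ-≤ (exprCost e) (≤-trans t≤a (m≤m+n _ _)))

ifFalse : ∀ {m} {e} {c d : Command m} {σ τ a b} → eval e σ ≡ nil →
  Run d σ τ b → Run (if e then c else d) σ τ (suc (exprCost e + (a + b)))
ifFalse {e = e} {a = a} eq (t , p , t≤b) = _ , if-false eq p , s≤s (+-monoʳ-≤ (exprCost e) (≤-trans t≤b (m≤n+m _ a)))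

whileStep : ∀ {m} {e} {c : Command m} {σ τ υ a b} → eval e σ ≢ nil →
  Run c σ τ a → Run (while e loop c) τ υ b → Run (while e loop c) σ υ (suc (exprCost e + (a + b)))
whileStep {e = e} ne (s , p , s≤a) (t , q , t≤b) =
  _ , while-true ne p q , s≤s (+-monoʳ-≤ (exprCost e) (+-mono-≤ s≤a t≤b))

whileStop : ∀ {m} {e} {c : Command m} {σ} → eval e σ ≡ nil → Run (while e loop c) σ σ (suc (exprCost e))
whileStop eq = _ , while-false eq , ≤-refl

pattern x₀ = zero
pattern x₁ = suc zero

X S : Expr 2
X = var x₀
S = var x₁

-- Variable x₀ holds argument and value; variable x₁ is a stack, which a program must leave as it was.
record FP {A B : Ty} (f : ⟦ A ⟧ → ⟦ B ⟧) : Set where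
  field
    body  : Command 2
    time  : Poly
    space : Poly
    runs  : ∀ x s → Run body (code {A} x ∷ s ∷ []) (code {B} (f x) ∷ s ∷ []) (⟪ time ⟫ (weight {A} x))
    grows : ∀ x → weight {B} (f x) ≤ ⟪ space ⟫ (weight {A} x)

open FP

private variable
  A B C P : Ty

polynomialTime : {I J : Set} {encodeI : I → Tree} {encodeJ : J → Tree} {f : ⟦ A ⟧ → ⟦ B ⟧} {h : I → J}
  (repI : I → ⟦ A ⟧) (repJ : J → ⟦ B ⟧) →
  (∀ x → code {A} (repI x) ≡ encodeI x) → (∀ y → code {B} (repJ y) ≡ encodeJ y) →
  (∀ x → f (repI x) ≡ repJ (h x)) → FP {A} {B} f → PolynomialTime encodeI encodeJ h
polynomialTime {A} {B} {encodeI = encodeI} {encodeJ} {f} {h} repI repJ eqI eqJ commutes F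
  -- `RunsInTime` charges for the output as well, hence the summand `space F`; the factor 3 passes
  -- from weights to sizes of codes.
  with monomial ((time F ⊕ space F) ⊚ (con 3 ⊛ arg))
... | a , b , _ , bound = record { locals = 1 ; body = body F } , a , b , halts
  where
  eqOut : ∀ x → code {B} (f (repI x)) ≡ encodeJ (h x)
  eqOut x = trans (cong (code {B}) (commutes x)) (eqJ (h x))
  halts : ∀ x → RunsInTime _ (encodeI x) (encodeJ (h x)) (a * size (encodeI x) ^ b)
  halts x with runs F (repI x) nil
  ... | t , p , t≤ = t , _ , subst (λ c → ⟨ _ ∣ c ∷ nil ∷ [] ⟩⇓[ t ] _) (eqI x) p , eqOut x , total
    where
    open ≤-Reasoning
    w = weight {A} (repI x)
    w≤ : w ≤ 3 * size (encodeI x)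
    w≤ = ≤-trans (weight≤3*size {A} (repI x)) (≤-reflexive (cong (λ c → 3 * size c) (eqI x)))
    1≤size : ∀ u → 1 ≤ size u
    1≤size nil = s≤s z≤n
    1≤size (cons _ _) = s≤s z≤n
    total : t + size (encodeJ (h x)) ≤ a * size (encodeI x) ^ b
    total = begin
      t + size (encodeJ (h x))              ≡⟨ cong (λ c → t + size c) (eqOut x) ⟨
      t + size (code {B} (f (repI x)))      ≤⟨ +-mono-≤ t≤ (≤-trans (size≤weight {B} _) (grows F (repI x))) ⟩
      ⟪ time F ⊕ space F ⟫ w                ≤⟨ ⟪⟫-mono (time F ⊕ space F) w≤ ⟩
      ⟪ time F ⊕ space F ⟫ (3 * size (encodeI x)) ≤⟨ bound _ (1≤size (encodeI x)) ⟩
      a * size (encodeI x) ^ b              ∎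

primitiveᶠ : {f : ⟦ A ⟧ → ⟦ B ⟧} (e : Expr 2) (Σ : Poly) →
  (∀ x s → eval e (code {A} x ∷ s ∷ []) ≡ code {B} (f x)) →
  (∀ x → weight {B} (f x) ≤ ⟪ Σ ⟫ (weight {A} x)) → FP {A} {B} f
primitiveᶠ {A} {B} {f} e Σ eq gr = record
  { body = x₀ ≔ e ; time = con (suc (exprCost e)) ; space = Σ ; grows = gr
  ; runs = λ x s → subst (λ c → Run (x₀ ≔ e) _ (c ∷ s ∷ []) _) (eq x s) assignment }

idᶠ : FP {A} {A} (λ x → x)
idᶠ = primitiveᶠ X arg (λ _ _ → refl) (λ _ → ≤-refl)

fstᶠ : FP {A ⊗ B} {A} proj₁
fstᶠ = primitiveᶠ (hd X) arg (λ _ _ → refl) (λ _ → ≤-trans (m≤m+n _ _) (n≤1+n _))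

sndᶠ : FP {A ⊗ B} {B} proj₂
sndᶠ {A} = primitiveᶠ (tl X) arg (λ _ _ → refl) (λ (x , _) → ≤-trans (m≤n+m _ (weight {A} x)) (n≤1+n _))

falseᶠ : FP {A} {bool} (λ _ → false)
falseᶠ = primitiveᶠ nil (con 3) (λ _ _ → refl) (λ _ → ≤-refl)

trueᶠ : FP {A} {bool} (λ _ → true)
trueᶠ = primitiveᶠ (cons nil nil) (con 3) (λ _ _ → refl) (λ _ → ≤-refl)

zeroᶠ : FP {A} {nat} (λ _ → zero)
zeroᶠ = primitiveᶠ nil (con 1) (λ _ _ → refl) (λ _ → ≤-refl)

[]ᶠ : FP {A} {list B} (λ _ → [])
[]ᶠ = primitiveᶠ nil (con 1) (λ _ _ → refl) (λ _ → ≤-refl)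

module _ {f : ⟦ A ⟧ → ⟦ B ⟧} where

  infixr 9 _∘ᶠ_

  _∘ᶠ_ : {g : ⟦ B ⟧ → ⟦ C ⟧} → FP {B} {C} g → FP {A} {B} f → FP {A} {C} (λ x → g (f x))
  G ∘ᶠ F = record
    { body  = body F ⨾ body G
    ; time  = time F ⊕ time G ⊚ space F
    ; space = space G ⊚ space F
    ; runs  = λ x s → runs F x s ▷ weaken (⟪⟫-mono (time G) (grows F x)) (runs G (f x) s)
    ; grows = λ x → ≤-trans (grows G (f x)) (⟪⟫-mono (space G) (grows F x))
    }

  infixr 4 _,ᶠ_

  _,ᶠ_ : {g : ⟦ A ⟧ → ⟦ C ⟧} → FP {A} {B} f → FP {A} {C} g → FP {A} {B ⊗ C} (λ x → f x , g x)
  F ,ᶠ G = record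
    -- The argument is pushed before `F` runs and the value of `F` before `G` runs; the last
    -- assignment pops both.
    { body  = x₁ ≔ cons X S ⨾ body F ⨾ x₁ ≔ cons X S ⨾ x₀ ≔ hd (tl S) ⨾ body G ⨾
              x₀ ≔ cons (hd S) X ⨾ x₁ ≔ tl (tl S)
    ; time  = con 4 ⊕ (time F ⊕ (con 4 ⊕ (con 4 ⊕ (time G ⊕ (con 5 ⊕ con 4)))))
    ; space = con 1 ⊕ (space F ⊕ space G)
    ; runs  = λ x s → assignment ▷ runs F x _ ▷ assignment ▷ assignment ▷ runs G x _ ▷ assignment ▷ assignment
    ; grows = λ x → s≤s (+-mono-≤ (grows F x) (grows G x))
    }

  ext : {g : ⟦ A ⟧ → ⟦ B ⟧} → (∀ x → f x ≡ g x) → FP {A} {B} f → FP {A} {B} g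
  ext eq F = record
    { body = body F ; time = time F ; space = space F
    ; runs = λ x s → subst (λ y → Run (body F) _ (code {B} y ∷ s ∷ []) _) (eq x) (runs F x s)
    ; grows = λ x → subst (λ y → weight {B} y ≤ _) (eq x) (grows F x) }

ifᶠ : {b : ⟦ A ⟧ → Bool} {f g : ⟦ A ⟧ → ⟦ B ⟧} →
  FP {A} {bool} b → FP {A} {B} f → FP {A} {B} g → FP {A} {B} (λ x → when b x then f x else g x)
ifᶠ {A} {B} {b} {f} {g} H F G = record
  { body  = x₁ ≔ cons X S ⨾ body H ⨾ x₁ ≔ cons X S ⨾ x₀ ≔ hd (tl S) ⨾
            if hd S then (x₁ ≔ tl (tl S) ⨾ body F) else (x₁ ≔ tl (tl S) ⨾ body G)
  ; time  = con 4 ⊕ (time H ⊕ (con 4 ⊕ (con 4 ⊕ (con 3 ⊕ ((con 4 ⊕ time F) ⊕ (con 4 ⊕ time G))))))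
  ; space = space F ⊕ space G
  ; runs  = λ x s → assignment ▷ runs H x _ ▷ assignment ▷ assignment ▷ branch x s
  ; grows = gr
  }
  where
  branch : ∀ x s → Run (if hd S then (x₁ ≔ tl (tl S) ⨾ body F) else (x₁ ≔ tl (tl S) ⨾ body G))
    (code {A} x ∷ cons (code {bool} (b x)) (cons (code {A} x) s) ∷ []) (code {B} (when b x then f x else g x) ∷ s ∷ [])
    (3 + ((4 + ⟪ time F ⟫ (weight {A} x)) + (4 + ⟪ time G ⟫ (weight {A} x))))
  branch x s with b x
  ... | true  = ifTrue (λ ()) (assignment {x = x₁} ▷ runs F x s)
  ... | false = ifFalse {a = 4 + ⟪ time F ⟫ (weight {A} x)} refl (assignment {x = x₁} ▷ runs G x s)
  gr : ∀ x → weight {B} (when b x then f x else g x) ≤ _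
  gr x with b x
  ... | true  = ≤-trans (grows F x) (m≤m+n _ _)
  ... | false = ≤-trans (grows G x) (m≤n+m _ _)

-- Primitive recursion on lists

para : {A P B : Set} → (P → B) → (P × A × List A × B → B) → P → List A → B
para z g p [] = z p
para z g p (x ∷ xs) = g (p , x , xs , para z g p xs)

-- The length of a polynomially long recursion does not bound its value by itself, hence the premise bounded.
paraᶠ : {z : ⟦ P ⟧ → ⟦ B ⟧} {g : ⟦ P ⟧ × ⟦ A ⟧ × List ⟦ A ⟧ × ⟦ B ⟧ → ⟦ B ⟧}
  (Σ : Poly) (bounded : ∀ p xs → weight {B} (para z g p xs) ≤ ⟪ Σ ⟫ (weight {P ⊗ list A} (p , xs))) →
  FP {P} {B} z → FP {P ⊗ A ⊗ list A ⊗ B} {B} g → FP {P ⊗ list A} {B} (λ (p , xs) → para z g p xs)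
paraᶠ {P} {B} {A} {z} {g} Σ bounded Z G = record
  { body  = x₁ ≔ cons X S ⨾ x₀ ≔ cons nil (tl X) ⨾ reverseLoop ⨾ x₁ ≔ cons (hd X) (cons nil S) ⨾
            x₀ ≔ hd (hd (tl (tl S))) ⨾ body Z ⨾ mainLoop ⨾ x₁ ≔ tl (tl (tl S))
  ; time  = con 4 ⊕ (con 5 ⊕ ((arg ⊛ con 14 ⊕ con 3) ⊕ (con 7 ⊕ (con 6 ⊕ (time Z ⊕
            ((arg ⊛ step ⊕ con 3) ⊕ con 5))))))
  ; space = Σ
  ; runs  = λ (p , xs) s → assignment ▷ assignment ▷
      weaken (+-monoˡ-≤ 3 (*-monoˡ-≤ 14 (length≤ p xs))) (reverseRuns xs [] _) ▷
      assignment ▷ assignment ▷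
      weaken (⟪⟫-mono (time Z) (≤-trans (m≤m+n _ _) (n≤1+n _))) (runs Z p _) ▷
      subst (λ ys → Run mainLoop (mainStore p s xs (reverse xs) []) (mainStore p s xs [] ys)
          (⟪ arg ⊛ step ⊕ con 3 ⟫ (weight {P ⊗ list A} (p , xs)))) (reverse-involutive′ xs)
        (weaken (+-monoˡ-≤ 3 (*-monoˡ-≤ _ (reverseLength p xs)))
          (mainRuns p s xs (reverse xs) [] (≤-reflexive (cong (λ ys → suc (weight {P} p + weight {list A} ys)) (reverse-involutive′ xs))))) ▷
      assignment
  ; grows = λ (p , xs) → bounded p xs
  }
  where
  reverseLoop mainLoop : Command 2
  reverseLoop = while tl X loop (x₀ ≔ cons (cons (hd (tl X)) (hd X)) (tl (tl X)))
  mainLoop = while hd S loop (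
    x₀ ≔ cons (hd (hd (tl (tl S)))) (cons (hd (hd S)) (cons (hd (tl S)) X)) ⨾ body G ⨾
    x₁ ≔ cons (tl (hd S)) (cons (cons (hd (hd S)) (hd (tl S))) (tl (tl S))))

  step : Poly
  -- One round of `mainLoop`: 3 for the guard, 16 for each of the two assignments, and the run of
  -- `G` on a tuple whose weight is bounded in `argument≤`.
  step = con 3 ⊕ (con 16 ⊕ (time G ⊚ (con 3 ⊕ (arg ⊕ Σ)) ⊕ con 16))

  reverse-involutive′ : (xs : List ⟦ A ⟧) → reverse xs ʳ++ [] ≡ xs
  reverse-involutive′ = reverse-involutive

  length≤ : ∀ p xs → length xs ≤ weight {P ⊗ list A} (p , xs)
  length≤ p xs = ≤-trans (length≤weight {A} xs) (≤-trans (m≤n+m _ (weight {P} p)) (n≤1+n _))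

  reverseLength : ∀ p xs → length (reverse xs) ≤ weight {P ⊗ list A} (p , xs)
  reverseLength p xs = ≤-trans (≤-reflexive (length-reverse xs)) (length≤ p xs)

  reverseRuns : ∀ xs ys s → Run reverseLoop (cons (code {list A} ys) (code {list A} xs) ∷ s ∷ [])
    (cons (code {list A} (xs ʳ++ ys)) nil ∷ s ∷ []) (length xs * 14 + 3)
  reverseRuns [] ys s = whileStop refl
  reverseRuns (x ∷ xs) ys s = whileStep (λ ()) assignment (reverseRuns xs (x ∷ ys) s)

  -- The loop invariant. Recursion evaluates from the end of the list, so the list is reversed
  -- first; elements then move from `rest` back to `done`, a suffix of `xs`, while `x₀` holds the
  -- value of the recursion on `done`.
  mainStore : ⟦ P ⟧ → Tree → (xs rest done : List ⟦ A ⟧) → Store 2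
  mainStore p s xs rest done = code {B} (para z g p done) ∷
    cons (code {list A} rest) (cons (code {list A} done) (cons (code {P ⊗ list A} (p , xs)) s)) ∷ []

  mainRuns : ∀ p s xs rest done {w} → weight {P ⊗ list A} (p , rest ʳ++ done) ≤ w →
    Run mainLoop (mainStore p s xs rest done) (mainStore p s xs [] (rest ʳ++ done)) (length rest * ⟪ step ⟫ w + 3)
  mainRuns p s xs [] done w≤ = whileStop refl
  mainRuns p s xs (x ∷ rest) done {w} w≤ = weaken regroup (whileStep (λ ())
      (assignment ▷ weaken (⟪⟫-mono (time G) argument≤) (runs G (p , x , done , para z g p done) _) ▷ assignment)
      (mainRuns p s xs rest (x ∷ done) w≤))
    where
    open ≤-Reasoning
    a = weight {P} p
    b = weight {A} x
    c = weight {list A} done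
    d = weight {B} (para z g p done)
    regroup : _ ≤ ⟪ step ⟫ w + length rest * ⟪ step ⟫ w + 3
    regroup = ≤-reflexive (sym (+-assoc (⟪ step ⟫ w) (length rest * ⟪ step ⟫ w) 3))
    here≤ : suc (a + suc (b + c)) ≤ w
    here≤ = ≤-trans (s≤s (+-monoʳ-≤ a (weight-ʳ++ {A} rest (x ∷ done)))) w≤
    value≤ : d ≤ ⟪ Σ ⟫ w
    value≤ = ≤-trans (bounded p done) (⟪⟫-mono Σ
      (≤-trans (s≤s (+-monoʳ-≤ a (≤-trans (m≤n+m c b) (n≤1+n _)))) here≤))
    argument≤ : suc (a + suc (b + suc (c + d))) ≤ 3 + (w + ⟪ Σ ⟫ w)
    argument≤ = begin
      suc (a + suc (b + suc (c + d)))   ≡⟨ solve 4 (λ a b c d → con′ 1 :+ (a :+ (con′ 1 :+ (b :+ (con′ 1 :+ (c :+ d)))))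
                                              := con′ 1 :+ ((con′ 1 :+ (a :+ (con′ 1 :+ (b :+ c)))) :+ d)) refl a b c d ⟩
      1 + (suc (a + suc (b + c)) + d)   ≤⟨ +-mono-≤ {1} {3} (s≤s z≤n) (+-mono-≤ here≤ value≤) ⟩
      3 + (w + ⟪ Σ ⟫ w)                 ∎

-- A step that adds to the previous value an amount polynomial in the other arguments adds, over the
-- whole list, at most its length times that amount. This discharges the premise `bounded` of
-- `paraᶠ`.
paraᶠ⁺ : {z : ⟦ P ⟧ → ⟦ B ⟧} {g : ⟦ P ⟧ × ⟦ A ⟧ × List ⟦ A ⟧ × ⟦ B ⟧ → ⟦ B ⟧} (Δ : Poly) →
  (∀ p x xs y → weight {B} (g (p , x , xs , y)) ≤ ⟪ Δ ⟫ (weight {P ⊗ A ⊗ list A} (p , x , xs)) + weight {B} y) →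
  FP {P} {B} z → FP {P ⊗ A ⊗ list A ⊗ B} {B} g → FP {P ⊗ list A} {B} (λ (p , xs) → para z g p xs)
paraᶠ⁺ {P} {B} {A} {z} {g} Δ step Z G = paraᶠ (arg ⊛ (Δ ⊚ (con 1 ⊕ arg)) ⊕ space Z) bounded Z G
  where
  go : ∀ p xs {w} → weight {P ⊗ list A} (p , xs) ≤ w →
    weight {B} (para z g p xs) ≤ length xs * ⟪ Δ ⟫ (1 + w) + ⟪ space Z ⟫ w
  go p [] w≤ = ≤-trans (grows Z p) (⟪⟫-mono (space Z) (≤-trans (≤-trans (m≤m+n _ _) (n≤1+n _)) w≤))
  go p (x ∷ xs) {w} w≤ = begin
    weight {B} (g (p , x , xs , para z g p xs))                  ≤⟨ step p x xs _ ⟩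
    ⟪ Δ ⟫ _ + weight {B} (para z g p xs)                         ≤⟨ +-mono-≤ (⟪⟫-mono Δ (≤-trans w≤ (n≤1+n w))) (go p xs tail≤) ⟩
    ⟪ Δ ⟫ (1 + w) + (length xs * ⟪ Δ ⟫ (1 + w) + ⟪ space Z ⟫ w)  ≡⟨ +-assoc (⟪ Δ ⟫ (1 + w)) _ _ ⟨
    length (x ∷ xs) * ⟪ Δ ⟫ (1 + w) + ⟪ space Z ⟫ w              ∎
    where
    open ≤-Reasoning
    tail≤ : suc (weight {P} p + weight {list A} xs) ≤ w
    tail≤ = ≤-trans (s≤s (+-monoʳ-≤ (weight {P} p) (≤-trans (m≤n+m _ (weight {A} x)) (n≤1+n _)))) w≤
  bounded : ∀ p xs → weight {B} (para z g p xs) ≤ ⟪ arg ⊛ (Δ ⊚ (con 1 ⊕ arg)) ⊕ space Z ⟫ (weight {P ⊗ list A} (p , xs))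
  bounded p xs = ≤-trans (go p xs ≤-refl) (+-monoˡ-≤ _ (*-monoˡ-≤ _
    (≤-trans (length≤weight {A} xs) (≤-trans (m≤n+m _ (weight {P} p)) (n≤1+n _)))))

-- Counting

bit : Bool → ℕ
bit true = 1
bit false = 0

count : {A : Set} → (A → Bool) → List A → ℕ
count p [] = 0
count p (x ∷ xs) = bit (p x) + count p xs

bit-T : ∀ {b} → T b → bit b ≡ 1
bit-T {true} _ = refl

bit-¬T : ∀ {b} → ¬ T b → bit b ≡ 0
bit-¬T {true} ¬b = contradiction _ ¬b
bit-¬T {false} _ = refl

bit-mono : ∀ {a b} → (T a → T b) → bit a ≤ bit b
bit-mono {false} _ = z≤n
bit-mono {true} {b} h = ≤-reflexive (sym (bit-T {b} (h _)))

module _ {A : Set} where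

  count-++ : ∀ (p : A → Bool) xs ys → count p (xs ++ ys) ≡ count p xs + count p ys
  count-++ p [] ys = refl
  count-++ p (x ∷ xs) ys = trans (cong (bit (p x) +_) (count-++ p xs ys)) (sym (+-assoc (bit (p x)) _ _))

  count-map : ∀ {B : Set} (p : B → Bool) (f : A → B) xs → count p (map f xs) ≡ count (λ x → p (f x)) xs
  count-map p f [] = refl
  count-map p f (x ∷ xs) = cong (bit (p (f x)) +_) (count-map p f xs)

  count-filter : ∀ (p q : A → Bool) xs → count p (filterᵇ q xs) ≡ count (λ x → q x ∧ p x) xs
  count-filter p q [] = refl
  count-filter p q (x ∷ xs) with q x
  ... | true  = cong (bit (p x) +_) (count-filter p q xs)
  ... | false = count-filter p q xs

  count-mono : ∀ (p q : A → Bool) xs → (∀ {x} → x ∈ xs → T (p x) → T (q x)) → count p xs ≤ count q xs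
  count-mono p q [] h = z≤n
  count-mono p q (x ∷ xs) h = +-mono-≤ (bit-mono (h (here refl))) (count-mono p q xs (λ x∈ → h (there x∈)))

  count-none : ∀ (p : A → Bool) xs → (∀ {x} → x ∈ xs → ¬ T (p x)) → count p xs ≡ 0
  count-none p [] h = refl
  count-none p (x ∷ xs) h rewrite bit-¬T {p x} (h (here refl)) = count-none p xs (λ x∈ → h (there x∈))

  count-length : ∀ (xs : List A) → count (λ _ → true) xs ≡ length xs
  count-length [] = refl
  count-length (x ∷ xs) = cong suc (count-length xs)

  length-filterᵇ : ∀ (q : A → Bool) xs → length (filterᵇ q xs) ≡ count q xs
  length-filterᵇ q [] = refl
  length-filterᵇ q (x ∷ xs) with q x
  ... | true  = cong suc (length-filterᵇ q xs)
  ... | false = length-filterᵇ q xs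

T⇒≡true : ∀ {b} → T b → b ≡ true
T⇒≡true {true} _ = refl

T-not : ∀ {b} → T (not b) → ¬ T b
T-not {false} _ ()

not-T : ∀ {b} → ¬ T b → T (not b)
not-T {false} _ = _
not-T {true} ¬b = contradiction _ ¬b

T-∧₁ : ∀ {a b} → T (a ∧ b) → T a
T-∧₁ {true} _ = _

T-∧₂ : ∀ {a b} → T (a ∧ b) → T b
T-∧₂ {true} h = h

T-∧ : ∀ {a b} → T a → T b → T (a ∧ b)
T-∧ {true} _ h = h

T-∨⁻ : ∀ {a b} → T (a ∨ b) → T a ⊎ T b
T-∨⁻ {true} _ = inj₁ _
T-∨⁻ {false} h = inj₂ h

T-∨ˡ : ∀ {a b} → T a → T (a ∨ b)
T-∨ˡ {true} _ = _

T-∨ʳ : ∀ {a b} → T b → T (a ∨ b)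
T-∨ʳ {true} _ = _
T-∨ʳ {false} h = h

-- The struction of Ebenegger, Hammer and de Werra

neighbours others : (ℕ → ℕ → Bool) → List ℕ → ℕ → List ℕ
neighbours E vs v = filterᵇ (E v) vs
others E vs v = filterᵇ (λ o → not (E v o) ∧ not (v ≡ᵇ o)) vs

nonPairs : {A : Set} → (A → A → Bool) → List A → List (A × A)
nonPairs E [] = []
nonPairs E (a ∷ as) = map (a ,_) (filterᵇ (λ b → not (E a b)) as) ++ nonPairs E as

-- A pair of non-adjacent neighbours of v replaces v and its neighbours; a remaining vertex o is written (o , o).
labels : (ℕ → ℕ → Bool) → List ℕ → ℕ → List (ℕ × ℕ)
labels E vs v = map (λ o → o , o) (others E vs v) ++ nonPairs E (neighbours E vs v)

-- The remaining vertices are not adjacent to `v`, so `E v a` says that the label `(a , b)` is a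
-- pair of neighbours. The first disjunct thus joins pairs of different layers, a layer being the
-- pairs with a common first component.
link : (ℕ → ℕ → Bool) → ℕ → ℕ × ℕ → ℕ × ℕ → Bool
link E v (a , b) (c , d) =
  (E v a ∧ E v c ∧ not (a ≡ᵇ c)) ∨ E a c ∨ E a d ∨ E b c ∨ E b d

Independent : {A : Set} → (A → A → Bool) → (A → Bool) → Set
Independent E i = ∀ x y → T (i x) → T (i y) → ¬ T (E x y)

module Struction (E : ℕ → ℕ → Bool)
                 (E-sym : ∀ {x y} → T (E x y) → T (E y x))
                 (E-irrefl : ∀ x → ¬ T (E x x)) where

  data Linked (v : ℕ) : ℕ × ℕ → ℕ × ℕ → Set where
    layers : ∀ {a b c d} → T (E v a) → T (E v c) → a ≢ c → Linked v (a , b) (c , d)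
    ₁₁ : ∀ {a b c d} → T (E a c) → Linked v (a , b) (c , d)
    ₁₂ : ∀ {a b c d} → T (E a d) → Linked v (a , b) (c , d)
    ₂₁ : ∀ {a b c d} → T (E b c) → Linked v (a , b) (c , d)
    ₂₂ : ∀ {a b c d} → T (E b d) → Linked v (a , b) (c , d)

  linked : ∀ v l m → T (link E v l m) → Linked v l m
  linked v (a , b) (c , d) h with T-∨⁻ {E v a ∧ E v c ∧ not (a ≡ᵇ c)} h
  ... | inj₁ p = layers (T-∧₁ {E v a} p) (T-∧₁ {E v c} (T-∧₂ {E v a} p))
                        (λ a≡c → T-not (T-∧₂ {E v c} (T-∧₂ {E v a} p)) (≡⇒≡ᵇ a c a≡c))
  ... | inj₂ p with T-∨⁻ {E a c} p
  ... | inj₁ e = ₁₁ e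
  ... | inj₂ q with T-∨⁻ {E a d} q
  ... | inj₁ e = ₁₂ e
  ... | inj₂ r with T-∨⁻ {E b c} r
  ... | inj₁ e = ₂₁ e
  ... | inj₂ e = ₂₂ e

  link-T : ∀ v l m → Linked v l m → T (link E v l m)
  link-T v (a , b) (c , d) (layers p q a≢c) = T-∨ˡ {E v a ∧ E v c ∧ not (a ≡ᵇ c)}
    (T-∧ {E v a} p (T-∧ {E v c} q (not-T (λ a≡c → a≢c (≡ᵇ⇒≡ a c a≡c)))))
  link-T v (a , b) (c , d) (₁₁ e) = T-∨ʳ {E v a ∧ _} (T-∨ˡ {E a c} e)
  link-T v (a , b) (c , d) (₁₂ e) = T-∨ʳ {E v a ∧ _} (T-∨ʳ {E a c} (T-∨ˡ {E a d} e))
  link-T v (a , b) (c , d) (₂₁ e) = T-∨ʳ {E v a ∧ _} (T-∨ʳ {E a c} (T-∨ʳ {E a d} (T-∨ˡ {E b c} e)))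
  link-T v (a , b) (c , d) (₂₂ e) = T-∨ʳ {E v a ∧ _} (T-∨ʳ {E a c} (T-∨ʳ {E a d} (T-∨ʳ {E b c} e)))

  link-sym : ∀ v l m → T (link E v l m) → T (link E v m l)
  link-sym v l m h = link-T v m l (flip (linked v l m h))
    where
    flip : ∀ {l m} → Linked v l m → Linked v m l
    flip (layers p q a≢c) = layers q p (λ c≡a → a≢c (sym c≡a))
    flip (₁₁ e) = ₁₁ (E-sym e)
    flip (₁₂ e) = ₂₁ (E-sym e)
    flip (₂₁ e) = ₁₂ (E-sym e)
    flip (₂₂ e) = ₂₂ (E-sym e)

  ∈-nonPairs : ∀ xs {a b} → (a , b) ∈ nonPairs E xs → a ∈ xs × b ∈ xs × ¬ T (E a b)
  ∈-nonPairs (x ∷ xs) h with ∈-++⁻ (map (x ,_) (filterᵇ (λ b → not (E x b)) xs)) h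
  ... | inj₂ k = let a∈ , b∈ , ¬e = ∈-nonPairs xs k in there a∈ , there b∈ , ¬e
  ... | inj₁ k with ∈-map⁻ (x ,_) k
  ... | b , b∈ , refl = let b∈xs , q = ∈-filter⁻ (λ b → T? (not (E x b))) b∈ in here refl , there b∈xs , T-not q

  module At (vs : List ℕ) (v : ℕ) where

    N O : List ℕ
    N = neighbours E vs v
    O = others E vs v

    L : List (ℕ × ℕ)
    L = labels E vs v

    ∈-N : ∀ {x} → x ∈ N → T (E v x)
    ∈-N x∈ = proj₂ (∈-filter⁻ (λ x → T? (E v x)) {xs = vs} x∈)

    ∈-O : ∀ {x} → x ∈ O → ¬ T (E v x)
    ∈-O {x} x∈ = T-not (T-∧₁ {not (E v x)} (proj₂ (∈-filter⁻ (λ x → T? (not (E v x) ∧ not (v ≡ᵇ x))) {xs = vs} x∈)))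

    ∈-L : ∀ {l} → l ∈ L → (∃[ o ] o ∈ O × l ≡ (o , o)) ⊎ l ∈ nonPairs E N
    ∈-L l∈ with ∈-++⁻ (map (λ o → o , o) O) l∈
    ... | inj₁ p = inj₁ (∈-map⁻ (λ o → o , o) p)
    ... | inj₂ q = inj₂ q

    -- Only the mixed cases `₁₂` and `₂₁` say something about a pair `(a , b)`: they would be an
    -- edge from `a` to `b`, and pairs are non-adjacent by choice.
    link-irrefl : ∀ {l} → l ∈ L → ¬ T (link E v l l)
    link-irrefl {l} l∈ h with ∈-L l∈ | linked v l l h
    ... | _ | layers _ _ a≢a = a≢a refl
    ... | _ | ₁₁ e = E-irrefl _ e
    ... | _ | ₂₂ e = E-irrefl _ e
    ... | inj₁ (o , _ , refl) | ₁₂ e = E-irrefl _ e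
    ... | inj₁ (o , _ , refl) | ₂₁ e = E-irrefl _ e
    ... | inj₂ l∈Q | ₁₂ e = proj₂ (proj₂ (∈-nonPairs N l∈Q)) e
    ... | inj₂ l∈Q | ₂₁ e = proj₂ (proj₂ (∈-nonPairs N l∈Q)) (E-sym e)

    count-L : ∀ p → count p L ≡ count (λ o → p (o , o)) O + count p (nonPairs E N)
    count-L p = trans (count-++ p (map (λ o → o , o) O) _) (cong (_+ count p (nonPairs E N)) (count-map p _ O))

    module _ (v∈vs : v ∈ vs) (unique : Unique vs) where

      count-v : ∀ (i : ℕ → Bool) → count (λ x → (v ≡ᵇ x) ∧ i x) vs ≡ bit (i v)
      count-v i = go vs unique v∈vs
        where
        go : ∀ xs → Unique xs → v ∈ xs → count (λ x → (v ≡ᵇ x) ∧ i x) xs ≡ bit (i v)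
        go (x ∷ xs) (x∉ ∷ _) (here refl) =
          trans (cong₂ _+_ (cong (λ b → bit (b ∧ i v)) (T⇒≡true (≡⇒≡ᵇ v v refl)))
                  (count-none _ xs λ {y} y∈ h → All.lookup x∉ y∈ (≡ᵇ⇒≡ v y (T-∧₁ {v ≡ᵇ y} h))))
                (+-identityʳ _)
        go (x ∷ xs) (x∉ ∷ u) (there v∈) =
          cong₂ _+_ (bit-¬T (λ h → All.lookup x∉ v∈ (sym (≡ᵇ⇒≡ v x (T-∧₁ {v ≡ᵇ x} h))))) (go xs u v∈)

      -- Irreflexivity keeps `v` out of `N` and uniqueness makes it occur once, so `N`, `O` and `v`
      -- partition the list.
      count-split : ∀ i → count i vs ≡ count i N + count i O + bit (i v)
      count-split i = trans (go vs) (cong₂ _+_ (cong₂ _+_ (sym (count-filter i (E v) vs)) (sym (count-filter i _ vs))) (count-v i))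
        where
        pointwise : ∀ x → bit (i x) ≡
          bit (E v x ∧ i x) + bit ((not (E v x) ∧ not (v ≡ᵇ x)) ∧ i x) + bit ((v ≡ᵇ x) ∧ i x)
        pointwise x with E v x in e | v ≡ᵇ x in eq
        ... | true  | true  = contradiction
          (subst (λ y → T (E v y)) (sym (≡ᵇ⇒≡ v x (subst T (sym eq) _))) (subst T (sym e) _)) (E-irrefl v)
        ... | true  | false = trans (sym (+-identityʳ _)) (sym (+-identityʳ _))
        ... | false | true  = refl
        ... | false | false = sym (+-identityʳ _)
        go : ∀ xs → count i xs ≡ count (λ x → E v x ∧ i x) xs
          + count (λ x → (not (E v x) ∧ not (v ≡ᵇ x)) ∧ i x) xs + count (λ x → (v ≡ᵇ x) ∧ i x) xs
        go [] = refl
        go (x ∷ xs) = trans (cong₂ _+_ (pointwise x) (go xs))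
          (solve 6 (λ a b c d e f → ((a :+ b) :+ c) :+ ((d :+ e) :+ f) := ((a :+ d) :+ (b :+ e)) :+ (c :+ f)) refl
            (bit (E v x ∧ i x)) _ (bit ((v ≡ᵇ x) ∧ i x)) (count (λ x → E v x ∧ i x) xs) _ _)

      length-split : length vs ≡ suc (length N + length O)
      length-split = begin
        length vs                                 ≡⟨ count-length vs ⟨
        count (λ _ → true) vs                     ≡⟨ count-split (λ _ → true) ⟩
        count _ N + count _ O + 1                 ≡⟨ +-comm _ 1 ⟩
        suc (count (λ _ → true) N + count (λ _ → true) O) ≡⟨ cong₂ (λ m n → suc (m + n)) (count-length N) (count-length O) ⟩
        suc (length N + length O)                 ∎
        where open ≡-Reasoning

      -- A set meeting N keeps its elements outside N and gives up its first neighbour a of v,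
      -- while every other b in N becomes the pair (a , b).  Otherwise it gives up at most v.
      module _ (i : ℕ → Bool) (ind : Independent E i) where

        forwardSet : ℕ → ℕ × ℕ → Bool
        forwardSet a (x , y) = i x ∧ i y ∧ (not (E v x) ∨ (x ≡ᵇ a))

        -- All components of kept labels lie in `i`, so an edge of `E` cannot link two of them; nor
        -- can the layer rule, since every kept pair has first component `a`.
        forward-independent : ∀ a → Independent (link E v) (forwardSet a)
        forward-independent a (x , y) (c , d) h k e with linked v (x , y) (c , d) e
        ... | ₁₁ e = ind _ _ (T-∧₁ {i x} h) (T-∧₁ {i c} k) e
        ... | ₁₂ e = ind _ _ (T-∧₁ {i x} h) (T-∧₁ {i d} (T-∧₂ {i c} k)) e
        ... | ₂₁ e = ind _ _ (T-∧₁ {i y} (T-∧₂ {i x} h)) (T-∧₁ {i c} k) e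
        ... | ₂₂ e = ind _ _ (T-∧₁ {i y} (T-∧₂ {i x} h)) (T-∧₁ {i d} (T-∧₂ {i c} k)) e
        ... | layers p q x≢c = x≢c (trans (≡a x y h p) (sym (≡a c d k q)))
          where
          ≡a : ∀ x y → T (forwardSet a (x , y)) → T (E v x) → x ≡ a
          ≡a x y h p with T-∨⁻ {not (E v x)} (T-∧₂ {i y} (T-∧₂ {i x} h))
          ... | inj₁ ¬e = contradiction p (T-not ¬e)
          ... | inj₂ x≡a = ≡ᵇ⇒≡ x a x≡a

        count-forward-O : ∀ a → count i O ≤ count (λ o → forwardSet a (o , o)) O
        count-forward-O a = count-mono _ _ O λ {x} x∈ h →
          T-∧ {i x} h (T-∧ {i x} h (T-∨ˡ {not (E v x)} (not-T (∈-O x∈))))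

        -- Take for `a` the first element of the list in `i`. By independence every later element
        -- `b` of `i` is non-adjacent to `a`, so `(a , b)` really occurs among the pairs; the `suc`
        -- accounts for `a`.
        count-forward-N : ∀ xs → count i xs ≡ 0 ⊎
          ∃[ a ] a ∈ xs × T (i a) × count i xs ≤ suc (count (forwardSet a) (nonPairs E xs))
        count-forward-N [] = inj₁ refl
        count-forward-N (x ∷ xs) with T? (i x)
        ... | yes ix = inj₂ (x , here refl , ix , (begin
            bit (i x) + count i xs                                  ≡⟨ cong (_+ count i xs) (bit-T {i x} ix) ⟩
            suc (count i xs)                                        ≤⟨ s≤s (count-mono _ _ xs λ {y} _ iy →
                                                                         T-∧ (not-T (ind x y ix iy)) (T-∧ ix (T-∧ iy (T-∨ʳ {not (E v x)} (≡⇒≡ᵇ x x refl))))) ⟩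
            suc (count (λ y → not (E x y) ∧ forwardSet x (x , y)) xs) ≡⟨ cong suc (count-filter _ _ xs) ⟨
            suc (count (λ y → forwardSet x (x , y)) ys)             ≡⟨ cong suc (count-map (forwardSet x) (x ,_) ys) ⟨
            suc (count (forwardSet x) (map (x ,_) ys))              ≤⟨ s≤s (m≤m+n _ _) ⟩
            suc (count (forwardSet x) (map (x ,_) ys) + count (forwardSet x) (nonPairs E xs)) ≡⟨ cong suc (count-++ (forwardSet x) (map (x ,_) ys) _) ⟨
            suc (count (forwardSet x) (nonPairs E (x ∷ xs)))        ∎))
          where
          open ≤-Reasoning
          ys = filterᵇ (λ y → not (E x y)) xs
        ... | no ¬ix with count-forward-N xs
        ... | inj₁ eq = inj₁ (cong₂ _+_ (bit-¬T ¬ix) eq)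
        ... | inj₂ (a , a∈ , ia , le) = inj₂ (a , there a∈ , ia , (begin
            bit (i x) + count i xs            ≡⟨ cong (_+ count i xs) (bit-¬T ¬ix) ⟩
            count i xs                        ≤⟨ le ⟩
            suc (count (forwardSet a) (nonPairs E xs)) ≤⟨ s≤s (m≤n+m _ _) ⟩
            suc (count (forwardSet a) block + count (forwardSet a) (nonPairs E xs)) ≡⟨ cong suc (count-++ (forwardSet a) block _) ⟨
            suc (count (forwardSet a) (nonPairs E (x ∷ xs))) ∎))
          where
          open ≤-Reasoning
          block = map (x ,_) (filterᵇ (λ y → not (E x y)) xs)

        forward : ∃[ j ] Independent (link E v) j × count i vs ≤ suc (count j L)
        forward with count-forward-N N
        -- With no neighbour chosen, `v` is merely a default layer: `forwardSet` is independent for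
        -- any layer, and the `suc` now accounts for `v` itself.
        ... | inj₁ eq = forwardSet v , forward-independent v , (begin
            count i vs                          ≡⟨ count-split i ⟩
            count i N + count i O + bit (i v)   ≡⟨ cong (λ k → k + count i O + bit (i v)) eq ⟩
            count i O + bit (i v)               ≤⟨ +-mono-≤ (count-forward-O v) (bit-mono {i v} {true} _) ⟩
            count (λ o → forwardSet v (o , o)) O + 1 ≡⟨ +-comm _ 1 ⟩
            suc (count (λ o → forwardSet v (o , o)) O) ≤⟨ s≤s (m≤m+n _ _) ⟩
            suc (count (λ o → forwardSet v (o , o)) O + count (forwardSet v) (nonPairs E N)) ≡⟨ cong suc (count-L (forwardSet v)) ⟨
            suc (count (forwardSet v) L)        ∎)
          where open ≤-Reasoning
        ... | inj₂ (a , a∈ , ia , le) = forwardSet a , forward-independent a , (begin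
            count i vs                          ≡⟨ count-split i ⟩
            count i N + count i O + bit (i v)   ≡⟨ cong (count i N + count i O +_) (bit-¬T (λ iv → ind v a iv ia (∈-N a∈))) ⟩
            count i N + count i O + 0           ≡⟨ +-identityʳ _ ⟩
            count i N + count i O               ≤⟨ +-mono-≤ le (count-forward-O a) ⟩
            suc (count (forwardSet a) (nonPairs E N) + count (λ o → forwardSet a (o , o)) O) ≡⟨ cong suc (+-comm _ (count (λ o → forwardSet a (o , o)) O)) ⟩
            suc (count (λ o → forwardSet a (o , o)) O + count (forwardSet a) (nonPairs E N)) ≡⟨ cong suc (count-L (forwardSet a)) ⟨
            suc (count (forwardSet a) L)        ∎)
          where open ≤-Reasoning

      module _ (j : ℕ × ℕ → Bool) (ind : Independent (link E v) j) (support : ∀ {l} → T (j l) → l ∈ L) where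

        diagonal : ∀ {x} → T (j (x , x)) → (∀ {l} → l ∈ nonPairs E N → ¬ T (j l)) → ¬ T (E v x)
        diagonal jx none with ∈-L (support jx)
        ... | inj₁ (o , o∈ , refl) = ∈-O o∈
        ... | inj₂ x∈Q = contradiction jx (none x∈Q)

        -- All pairs in j have the same first component, because different layers are joined completely.
        module _ {a b : ℕ} (ab∈Q : (a , b) ∈ nonPairs E N) (jab : T (j (a , b))) where

          backwardSet : ℕ → Bool
          backwardSet x = (x ≡ᵇ a) ∨ j (x , x) ∨ j (a , x)

          a∈N : a ∈ N
          a∈N = proj₁ (∈-nonPairs N ab∈Q)

          data InSet : ℕ → Set where
            first  : InSet a
            other  : ∀ {x} → T (j (x , x)) → InSet x
            second : ∀ {x} → T (j (a , x)) → ¬ T (E a x) → InSet x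

          inSet : ∀ x → T (backwardSet x) → InSet x
          inSet x h with T-∨⁻ {x ≡ᵇ a} h
          ... | inj₁ x≡a = subst InSet (sym (≡ᵇ⇒≡ x a x≡a)) first
          ... | inj₂ k with T-∨⁻ {j (x , x)} k
          ... | inj₁ jx = other jx
          ... | inj₂ jax with ∈-L (support jax)
          ... | inj₁ (o , _ , refl) = other jax
          ... | inj₂ ax∈Q = second jax (proj₂ (proj₂ (∈-nonPairs N ax∈Q)))

          -- Each element is a component of a chosen label, and an edge between components of two
          -- chosen labels would link them. The exception is `a` against a second component: both
          -- may come from the same pair, whose non-adjacency is stored in `second`.
          backward-independent : Independent E backwardSet
          backward-independent x y h k e = go (inSet x h) (inSet y k) e
            where
            unlinked : ∀ {l m} → T (j l) → T (j m) → ¬ Linked v l m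
            unlinked {l} {m} jl jm s = ind l m jl jm (link-T v l m s)
            go : ∀ {x y} → InSet x → InSet y → ¬ T (E x y)
            go first first e = E-irrefl a e
            go first (other jy) e = unlinked jab jy (₁₁ e)
            go first (second _ ¬e) e = ¬e e
            go (other jx) first e = unlinked jx jab (₁₁ e)
            go (other jx) (other jy) e = unlinked jx jy (₁₁ e)
            go (other jx) (second jy _) e = unlinked jx jy (₁₂ e)
            go (second _ ¬e) first e = ¬e (E-sym e)
            go (second jx _) (other jy) e = unlinked jx jy (₂₁ e)
            go (second jx _) (second jy _) e = unlinked jx jy (₂₂ e)

          firstComponent : ∀ {c d} → T (E v c) → T (j (c , d)) → c ≡ a
          firstComponent {c} {d} vc jcd with c ≟ a
          ... | yes c≡a = c≡a
          ... | no c≢a = contradiction (link-T v (c , d) (a , b) (layers vc (∈-N a∈N) c≢a)) (ind (c , d) (a , b) jcd jab)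

          count-backward-∉ : ∀ xs → (∀ {x} → x ∈ xs → T (E v x)) → All (a ≢_) xs → count j (nonPairs E xs) ≡ 0
          count-backward-∉ xs xs⊆ a∉ = count-none j (nonPairs E xs) λ {(c , d)} cd∈ jcd →
            let c∈ = proj₁ (∈-nonPairs xs cd∈) in All.lookup a∉ c∈ (sym (firstComponent (xs⊆ c∈) jcd))

          -- Since all chosen pairs have first component `a`, only the block of `nonPairs` headed by
          -- `a` contributes. There each chosen `(a , y)` puts `y` into the set, and `a` itself pays
          -- for the `suc`.
          count-backward-N : ∀ xs → (∀ {x} → x ∈ xs → T (E v x)) → Unique xs → a ∈ xs →
            suc (count j (nonPairs E xs)) ≤ count backwardSet xs
          count-backward-N (x ∷ xs) xs⊆ (x∉ ∷ u) a∈ = begin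
              suc (count j (nonPairs E (x ∷ xs)))                   ≡⟨ cong suc (count-++ j (map (x ,_) ys) _) ⟩
              suc (count j (map (x ,_) ys) + count j (nonPairs E xs)) ≡⟨ cong (λ k → suc (k + count j (nonPairs E xs)))
                                                                         (trans (count-map j (x ,_) ys) (count-filter _ _ xs)) ⟩
              suc (count (λ y → not (E x y) ∧ j (x , y)) xs + count j (nonPairs E xs)) ≤⟨ cases a∈ ⟩
              bit (backwardSet x) + count backwardSet xs            ∎
            where
            open ≤-Reasoning
            ys = filterᵇ (λ y → not (E x y)) xs
            cases : a ∈ x ∷ xs → suc (count (λ y → not (E x y) ∧ j (x , y)) xs + count j (nonPairs E xs)) ≤
              bit (backwardSet x) + count backwardSet xs
            cases (here refl) rewrite count-backward-∉ xs (λ y∈ → xs⊆ (there y∈)) x∉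
                                    | bit-T {backwardSet a} (T-∨ˡ (≡⇒≡ᵇ a a refl)) =
              s≤s (≤-trans (≤-reflexive (+-identityʳ _)) (count-mono _ _ xs λ {y} _ h →
                T-∨ʳ {y ≡ᵇ a} (T-∨ʳ {j (y , y)} (T-∧₂ {not (E a y)} h))))
            cases (there a∈xs) rewrite count-none (λ y → not (E x y) ∧ j (x , y)) xs
                (λ {y} _ h → All.lookup x∉ a∈xs (firstComponent (xs⊆ (here refl)) (T-∧₂ {not (E x y)} h))) =
              ≤-trans (count-backward-N xs (λ y∈ → xs⊆ (there y∈)) u a∈xs) (m≤n+m _ (bit (backwardSet x)))

        backward : ∃[ i ] Independent E i × suc (count j L) ≤ count i vs
        backward with any? (λ l → T? (j l)) (nonPairs E N)
        ... | yes some with find some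
        ... | (a , b) , ab∈Q , jab = i , backward-independent ab∈Q jab , (begin
            suc (count j L)                                                   ≡⟨ cong suc (count-L j) ⟩
            suc (count (λ o → j (o , o)) O + count j (nonPairs E N))          ≡⟨ +-suc _ _ ⟨
            count (λ o → j (o , o)) O + suc (count j (nonPairs E N))          ≤⟨ +-mono-≤
                (count-mono _ _ O λ {x} _ jx → T-∨ʳ {x ≡ᵇ a} (T-∨ˡ {j (x , x)} jx))
                (count-backward-N ab∈Q jab N ∈-N (Unique.filter⁺ _ unique) (a∈N ab∈Q jab)) ⟩
            count i O + count i N                                             ≡⟨ +-comm (count i O) _ ⟩
            count i N + count i O                                             ≤⟨ m≤m+n _ _ ⟩
            count i N + count i O + bit (i v)                                 ≡⟨ count-split i ⟨
            count i vs                                                        ∎)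
          where
          open ≤-Reasoning
          i = backwardSet ab∈Q jab
        -- Without a chosen pair, all chosen labels are remaining vertices, hence non-neighbours of
        -- `v`, and `v` can be added to the set.
        backward | no ¬some = i , ind′ , (begin
            suc (count j L)                                                   ≡⟨ cong suc (count-L j) ⟩
            suc (count (λ o → j (o , o)) O + count j (nonPairs E N))          ≡⟨ cong (λ k → suc (count (λ o → j (o , o)) O + k)) (count-none j (nonPairs E N) none) ⟩
            suc (count (λ o → j (o , o)) O + 0)                               ≡⟨ cong suc (+-identityʳ _) ⟩
            suc (count (λ o → j (o , o)) O)                                   ≤⟨ s≤s (count-mono _ _ O λ {x} _ jx → T-∨ʳ {x ≡ᵇ v} jx) ⟩
            suc (count i O)                                                   ≤⟨ s≤s (m≤n+m _ (count i N)) ⟩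
            suc (count i N + count i O)                                       ≡⟨ +-comm 1 _ ⟩
            count i N + count i O + 1                                         ≡⟨ cong (count i N + count i O +_) (bit-T {i v} (T-∨ˡ (≡⇒≡ᵇ v v refl))) ⟨
            count i N + count i O + bit (i v)                                 ≡⟨ count-split i ⟨
            count i vs                                                        ∎)
          where
          open ≤-Reasoning
          none : ∀ {l} → l ∈ nonPairs E N → ¬ T (j l)
          none l∈ jl = ¬some (lose l∈ jl)
          i : ℕ → Bool
          i x = (x ≡ᵇ v) ∨ j (x , x)
          ind′ : Independent E i
          ind′ x y h k e with T-∨⁻ {x ≡ᵇ v} h | T-∨⁻ {y ≡ᵇ v} k
          ... | inj₁ x≡v | inj₁ y≡v rewrite ≡ᵇ⇒≡ x v x≡v | ≡ᵇ⇒≡ y v y≡v = E-irrefl v e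
          ... | inj₁ x≡v | inj₂ jy rewrite ≡ᵇ⇒≡ x v x≡v = diagonal jy none e
          ... | inj₂ jx | inj₁ y≡v rewrite ≡ᵇ⇒≡ y v y≡v = diagonal jx none (E-sym e)
          ... | inj₂ jx | inj₂ jy = ind (x , x) (y , y) jx jy (link-T v (x , x) (y , y) (₁₁ e))

-- Programs for the reduction

[]-or-tail : {A : Set} → List A → List A
[]-or-tail [] = []
[]-or-tail (_ ∷ xs) = xs

headOr : {A : Set} → A → List A → A
headOr d [] = d
headOr d (x ∷ _) = x

weight-++ : ∀ {A} (xs ys : ⟦ list A ⟧) → weight {list A} (xs ++ ys) ≤ weight {list A} xs + weight {list A} ys
weight-++ [] ys = n≤1+n _
weight-++ {A} (x ∷ xs) ys = s≤s (≤-trans (+-monoʳ-≤ (weight {A} x) (weight-++ {A} xs ys))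
  (≤-reflexive (sym (+-assoc (weight {A} x) _ _))))

weight-length : ∀ {A} (xs : ⟦ list A ⟧) → weight {nat} (length xs) ≤ weight {list A} xs
weight-length [] = ≤-refl
weight-length {A} (x ∷ xs) = s≤s (+-mono-≤ (1≤weight {A} x) (weight-length {A} xs))

∷ᶠ : FP {A ⊗ list A} {list A} (λ (x , xs) → x ∷ xs)
∷ᶠ = primitiveᶠ X arg (λ _ _ → refl) (λ _ → ≤-refl)

tailᶠ : FP {list A} {list A} []-or-tail
tailᶠ {A} = primitiveᶠ (tl X) arg (λ { [] s → refl ; (x ∷ xs) s → refl })
  (λ { [] → ≤-refl ; (x ∷ xs) → ≤-trans (m≤n+m _ (weight {A} x)) (n≤1+n _) })

-- The head of `nil` is `nil`, so the default comes for free when its code is `nil`.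
headOrᶠ : (d : ⟦ A ⟧) → nil ≡ code {A} d → FP {list A} {A} (headOr d)
headOrᶠ {A} d d≡nil = primitiveᶠ (hd X) (con (weight {A} d) ⊕ arg)
  (λ { [] s → d≡nil ; (x ∷ xs) s → refl })
  (λ { [] → m≤m+n _ _ ; (x ∷ xs) → ≤-trans (≤-trans (m≤m+n _ _) (n≤1+n _)) (m≤n+m _ (weight {A} d)) })

sucᶠ : FP {nat} {nat} suc
sucᶠ = primitiveᶠ (cons nil X) (con 2 ⊕ arg) (λ _ _ → refl) (λ _ → ≤-refl)

predᶠ : FP {nat} {nat} pred
predᶠ = primitiveᶠ (tl X) arg (λ { zero s → refl ; (suc n) s → refl })
  (λ { zero → ≤-refl ; (suc n) → ≤-trans (n≤1+n _) (n≤1+n _) })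

notᶠ : {f : ⟦ A ⟧ → Bool} → FP {A} {bool} f → FP {A} {bool} (λ x → not (f x))
notᶠ {f = f} F = ext (λ x → eq (f x)) (ifᶠ F falseᶠ trueᶠ)
  where
  eq : ∀ b → (when b then false else true) ≡ not b
  eq true = refl
  eq false = refl

infixr 6 _∧ᶠ_
infixr 5 _∨ᶠ_

_∧ᶠ_ : {f g : ⟦ A ⟧ → Bool} → FP {A} {bool} f → FP {A} {bool} g → FP {A} {bool} (λ x → f x ∧ g x)
_∧ᶠ_ {f = f} {g} F G = ext (λ x → eq (f x) (g x)) (ifᶠ F G falseᶠ)
  where
  eq : ∀ a b → (when a then b else false) ≡ a ∧ b
  eq true b = refl
  eq false b = refl

_∨ᶠ_ : {f g : ⟦ A ⟧ → Bool} → FP {A} {bool} f → FP {A} {bool} g → FP {A} {bool} (λ x → f x ∨ g x)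
_∨ᶠ_ {f = f} {g} F G = ext (λ x → eq (f x) (g x)) (ifᶠ F trueᶠ G)
  where
  eq : ∀ a b → (when a then true else b) ≡ a ∨ b
  eq true b = refl
  eq false b = refl

caseᶠ : {z : ⟦ P ⟧ → ⟦ B ⟧} {g : ⟦ P ⟧ × ⟦ A ⟧ × List ⟦ A ⟧ → ⟦ B ⟧} →
  FP {P} {B} z → FP {P ⊗ A ⊗ list A} {B} g →
  FP {P ⊗ list A} {B} (λ (p , xs) → para z (λ (p , x , ys , _) → g (p , x , ys)) p xs)
caseᶠ {P} {B} {A} {z} {g} Z G = paraᶠ⁺ (space G) (λ p x xs y → ≤-trans (grows G (p , x , xs)) (m≤m+n _ _)) Z
  (G ∘ᶠ (fstᶠ ,ᶠ (fstᶠ ∘ᶠ sndᶠ) ,ᶠ (fstᶠ ∘ᶠ sndᶠ ∘ᶠ sndᶠ)))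

mapᶠ : {g : ⟦ P ⟧ × ⟦ A ⟧ → ⟦ B ⟧} → FP {P ⊗ A} {B} g →
  FP {P ⊗ list A} {list B} (λ (p , xs) → map (λ x → g (p , x)) xs)
mapᶠ {P} {A} {B} {g} G = ext (λ (p , xs) → eq p xs)
  (paraᶠ⁺ (con 1 ⊕ space G ⊚ (con 1 ⊕ arg)) step []ᶠ (∷ᶠ ∘ᶠ (G ∘ᶠ (fstᶠ ,ᶠ fstᶠ ∘ᶠ sndᶠ) ,ᶠ sndᶠ ∘ᶠ sndᶠ ∘ᶠ sndᶠ)))
  where
  eq : ∀ p xs → para (λ _ → []) (λ (p , x , _ , ys) → g (p , x) ∷ ys) p xs ≡ map (λ x → g (p , x)) xs
  eq p [] = refl
  eq p (x ∷ xs) = cong (g (p , x) ∷_) (eq p xs)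
  step : ∀ p x xs ys → weight {list B} (g (p , x) ∷ ys) ≤
    1 + ⟪ space G ⟫ (1 + weight {P ⊗ A ⊗ list A} (p , x , xs)) + weight {list B} ys
  step p x xs ys = s≤s (+-monoˡ-≤ _ (≤-trans (grows G (p , x)) (⟪⟫-mono (space G)
    (s≤s (≤-trans (+-monoʳ-≤ (weight {P} p) (≤-trans (m≤m+n (weight {A} x) _) (n≤1+n _))) (n≤1+n _))))))

filterᶠ : {b : ⟦ P ⟧ × ⟦ A ⟧ → Bool} → FP {P ⊗ A} {bool} b →
  FP {P ⊗ list A} {list A} (λ (p , xs) → filterᵇ (λ x → b (p , x)) xs)
filterᶠ {P} {A} {b} H = ext (λ (p , xs) → eq p xs)
  (paraᶠ⁺ (con 1 ⊕ arg) step []ᶠ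
    (ifᶠ (H ∘ᶠ (fstᶠ ,ᶠ fstᶠ ∘ᶠ sndᶠ)) (∷ᶠ ∘ᶠ (fstᶠ ∘ᶠ sndᶠ ,ᶠ sndᶠ ∘ᶠ sndᶠ ∘ᶠ sndᶠ)) (sndᶠ ∘ᶠ sndᶠ ∘ᶠ sndᶠ)))
  where
  eq : ∀ p xs → para (λ _ → []) (λ (p , x , _ , ys) → when b (p , x) then x ∷ ys else ys) p xs ≡ filterᵇ (λ x → b (p , x)) xs
  eq p [] = refl
  eq p (x ∷ xs) with b (p , x)
  ... | true  = cong (x ∷_) (eq p xs)
  ... | false = eq p xs
  step : ∀ p x xs ys → weight {list A} (when b (p , x) then x ∷ ys else ys) ≤
    1 + weight {P ⊗ A ⊗ list A} (p , x , xs) + weight {list A} ys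
  step p x xs ys with b (p , x)
  ... | true  = s≤s (+-monoˡ-≤ _ (≤-trans (≤-trans (≤-trans (m≤m+n (weight {A} x) _) (n≤1+n _)) (m≤n+m _ (weight {P} p))) (n≤1+n _)))
  ... | false = m≤n+m _ _

++ᶠ : FP {list A ⊗ list A} {list A} (λ (xs , ys) → xs ++ ys)
++ᶠ {A} = ext (λ (xs , ys) → eq xs ys)
  (paraᶠ⁺ (con 1 ⊕ arg) step idᶠ (∷ᶠ ∘ᶠ (fstᶠ ∘ᶠ sndᶠ ,ᶠ sndᶠ ∘ᶠ sndᶠ ∘ᶠ sndᶠ)) ∘ᶠ (sndᶠ ,ᶠ fstᶠ))
  where
  eq : ∀ xs ys → para (λ zs → zs) (λ (_ , x , _ , zs) → x ∷ zs) ys xs ≡ xs ++ ys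
  eq [] ys = refl
  eq (x ∷ xs) ys = cong (x ∷_) (eq xs ys)
  step : ∀ p x xs ys → weight {list A} (x ∷ ys) ≤ 1 + weight {list A ⊗ A ⊗ list A} (p , x , xs) + weight {list A} ys
  step p x xs ys = s≤s (+-monoˡ-≤ _ (≤-trans (≤-trans (≤-trans (m≤m+n (weight {A} x) _) (n≤1+n _)) (m≤n+m _ (weight {list A} p))) (n≤1+n _)))

lengthᶠ : FP {list A} {nat} length
lengthᶠ {A} = ext eq (paraᶠ⁺ {P = bool} {A = A} (con 2) (λ _ _ _ _ → ≤-refl) zeroᶠ (sucᶠ ∘ᶠ sndᶠ ∘ᶠ sndᶠ ∘ᶠ sndᶠ) ∘ᶠ (falseᶠ ,ᶠ idᶠ))
  where
  eq : ∀ xs → para (λ _ → zero) (λ (_ , _ , _ , n) → suc n) false xs ≡ length xs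
  eq [] = refl
  eq (x ∷ xs) = cong suc (eq xs)

indicesᶠ : FP {list A} {list nat} (λ xs → upTo (length xs))
indicesᶠ {A} = ext eq (paraᶠ⁺ {P = bool} {A = A} (con 3 ⊕ arg) step []ᶠ
  (++ᶠ ∘ᶠ (sndᶠ ∘ᶠ sndᶠ ∘ᶠ sndᶠ ,ᶠ ∷ᶠ ∘ᶠ (lengthᶠ ∘ᶠ fstᶠ ∘ᶠ sndᶠ ∘ᶠ sndᶠ ,ᶠ []ᶠ))) ∘ᶠ (falseᶠ ,ᶠ idᶠ))
  where
  eq : ∀ xs → para (λ _ → []) (λ (_ , _ , xs , ns) → ns ++ length xs ∷ []) false xs ≡ upTo (length xs)
  eq [] = refl
  eq (x ∷ xs) = trans (cong (_++ length xs ∷ []) (eq xs)) (upTo-∷ʳ (length xs))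
  step : ∀ p x xs ns → weight {list nat} (ns ++ length xs ∷ []) ≤
    3 + weight {bool ⊗ A ⊗ list A} (p , x , xs) + weight {list nat} ns
  step p x xs ns = begin
    weight {list nat} (ns ++ length xs ∷ [])            ≤⟨ weight-++ {nat} ns (length xs ∷ []) ⟩
    w + suc (weight {nat} (length xs) + 1)              ≤⟨ +-monoʳ-≤ w (s≤s (+-mono-≤ le (s≤s z≤n))) ⟩
    w + suc (W + 2)                                     ≡⟨ trans (+-comm w _) (cong (λ k → suc (k + w)) (+-comm W 2)) ⟩
    3 + W + w                                           ∎
    where
    open ≤-Reasoning
    w = weight {list nat} ns
    W = weight {bool ⊗ A ⊗ list A} (p , x , xs)
    le : weight {nat} (length xs) ≤ W
    le = ≤-trans (weight-length {A} xs) (m≤n+m _ (5 + weight {A} x))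

-- A number and a list of that many `false` have the same code, so the program is the identity. It
-- turns recursion on numbers into recursion on lists.
unaryᶠ : FP {nat} {list bool} (λ n → replicate n false)
unaryᶠ = primitiveᶠ X (con 2 ⊛ arg) (λ n s → eq n) le
  where
  eq : ∀ n → code {nat} n ≡ code {list bool} (replicate n false)
  eq zero = refl
  eq (suc n) = cong (cons nil) (eq n)
  le : ∀ n → weight {list bool} (replicate n false) ≤ 2 * weight {nat} n
  le zero = s≤s z≤n
  le (suc n) = ≤-trans (+-monoʳ-≤ 4 (le n)) (≤-reflexive (sym (*-distribˡ-+ 2 2 (weight {nat} n))))

-- A step that never increases the weight keeps every iterate below the start. This covers tails,
-- predecessors and budget decrements.
foldᶠ : {g : ⟦ A ⟧ → ⟦ A ⟧} → (∀ x → weight {A} (g x) ≤ weight {A} x) → FP {A} {A} g →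
  FP {A ⊗ nat} {A} (λ (x , n) → fold x g n)
foldᶠ {A} {g} le G = ext (λ (x , n) → eq x n)
  (paraᶠ⁺ (con 0) (λ _ _ _ y → le y) idᶠ (G ∘ᶠ sndᶠ ∘ᶠ sndᶠ ∘ᶠ sndᶠ) ∘ᶠ (fstᶠ ,ᶠ unaryᶠ ∘ᶠ sndᶠ))
  where
  eq : ∀ x n → para (λ x → x) (λ (_ , _ , _ , y) → g y) x (replicate n false) ≡ fold x g n
  eq x zero = refl
  eq x (suc n) = cong g (eq x n)

dropᶠ : FP {list A ⊗ nat} {list A} (λ (xs , n) → drop n xs)
dropᶠ {A} = ext (λ (xs , n) → eq xs n) (foldᶠ (grows tailᶠ) tailᶠ)
  where
  tail-drop : ∀ xs n → []-or-tail (drop n xs) ≡ drop (suc n) xs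
  tail-drop [] zero = refl
  tail-drop [] (suc n) = refl
  tail-drop (x ∷ xs) zero = refl
  tail-drop (x ∷ xs) (suc n) = tail-drop xs n
  eq : (xs : ⟦ list A ⟧) (n : ℕ) → fold xs []-or-tail n ≡ drop n xs
  eq xs zero = refl
  eq xs (suc n) = trans (cong []-or-tail (eq xs n)) (tail-drop xs n)

∸ᶠ : FP {nat ⊗ nat} {nat} (λ (m , n) → m ∸ n)
∸ᶠ = ext (λ (m , n) → eq m n) (foldᶠ (grows predᶠ) predᶠ)
  where
  eq : ∀ m n → fold m pred n ≡ m ∸ n
  eq m zero = refl
  eq m (suc n) = trans (cong pred (eq m n)) (pred[m∸n]≡m∸[1+n] m n)

isZeroᶠ : FP {nat} {bool} (_≡ᵇ 0)
isZeroᶠ = ext eq (caseᶠ {P = bool} {A = bool} trueᶠ falseᶠ ∘ᶠ (falseᶠ ,ᶠ unaryᶠ))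
  where
  eq : ∀ n → para (λ _ → true) (λ _ → false) false (replicate n false) ≡ (n ≡ᵇ 0)
  eq zero = refl
  eq (suc n) = refl

≡ᵇᶠ : FP {nat ⊗ nat} {bool} (λ (m , n) → m ≡ᵇ n)
≡ᵇᶠ = ext (λ (m , n) → eq m n) (isZeroᶠ ∘ᶠ ∸ᶠ ∧ᶠ isZeroᶠ ∘ᶠ ∸ᶠ ∘ᶠ (sndᶠ ,ᶠ fstᶠ))
  where
  eq : ∀ m n → (m ∸ n ≡ᵇ 0) ∧ (n ∸ m ≡ᵇ 0) ≡ (m ≡ᵇ n)
  eq zero zero = refl
  eq zero (suc n) = refl
  eq (suc m) zero = refl
  eq (suc m) (suc n) = eq m n

-- Entries outside the matrix are read as false.
edge : List (List Bool) → ℕ → ℕ → Bool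
edge M u v = headOr false (drop v (headOr [] (drop u M)))

indices : List (List Bool) → List ℕ
indices M = upTo (length M)

neighbourList otherList : List (List Bool) → ℕ → List ℕ
neighbourList M v = neighbours (edge M) (indices M) v
otherList M v = others (edge M) (indices M) v

labelList : List (List Bool) → ℕ → List (ℕ × ℕ)
labelList M v = labels (edge M) (indices M) v

-- The difference `p − q` by which the cover number drops; the truncation is harmless at a
-- `reducible` vertex, where `q ≤ p`.
gain : List (List Bool) → ℕ → ℕ
gain M v = length (neighbourList M v) ∸ length (nonPairs (edge M) (neighbourList M v))

reducible : List (List Bool) → ℕ → Bool
reducible M v = length (nonPairs (edge M) (neighbourList M v)) ∸ length (neighbourList M v) ≡ᵇ 0

structionMatrix : List (List Bool) → ℕ → List (List Bool)
structionMatrix M v = map (λ l → map (link (edge M) v l) (labelList M v)) (labelList M v)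

-- In bijective binary `true` is the digit 2 and `false` the digit 1. The predecessor of `2 + 2x` is
-- `1 + 2x`; that of `1 + 2x` is `0` if `x = 0` and `2 + 2(x − 1)` otherwise.
predDigits : List Bool → List Bool
predDigits [] = []
predDigits (true ∷ ds) = false ∷ ds
predDigits (false ∷ ds) = when length ds ≡ᵇ 0 then [] else true ∷ predDigits ds

-- A negative budget stays as it is, which makes the code of the budget never grow.
decrement : Bool × List Bool → Bool × List Bool
decrement (true , ds) = true , ds
decrement (false , ds) = when length ds ≡ᵇ 0 then (true , []) else (false , predDigits ds)

State : Set
State = List (List Bool) × Bool × List Bool

reduceAt : State → ℕ → State
reduceAt (M , k) v = structionMatrix M v , fold k decrement (gain M v)

stepOn : State → List ℕ → State
stepOn s [] = s
stepOn s (v ∷ _) = reduceAt s v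

step : State → State
step (M , k) = stepOn (M , k) (filterᵇ (reducible M) (indices M))

reduceState : State → State
reduceState (M , k) = fold (M , k) step (length M)

pattern mat = list (list bool)
pattern budgetTy = bool ⊗ list bool

-- Compiling the reduction step

secondᶠ : FP {A ⊗ B ⊗ C} {B} (λ (_ , y , _) → y)
secondᶠ = fstᶠ ∘ᶠ sndᶠ

thirdᶠ : FP {A ⊗ B ⊗ C} {C} (λ (_ , _ , z) → z)
thirdᶠ = sndᶠ ∘ᶠ sndᶠ

edgeᶠ : FP {mat ⊗ nat ⊗ nat} {bool} (λ (M , u , v) → edge M u v)
edgeᶠ = headOrᶠ {bool} false refl ∘ᶠ dropᶠ {bool} ∘ᶠ
  (headOrᶠ {list bool} [] refl ∘ᶠ dropᶠ {list bool} ∘ᶠ (fstᶠ ,ᶠ secondᶠ) ,ᶠ thirdᶠ)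

neighbourListᶠ : FP {mat ⊗ nat} {list nat} (λ (M , v) → neighbourList M v)
neighbourListᶠ = filterᶠ {P = mat ⊗ nat} {A = nat} (edgeᶠ ∘ᶠ (fstᶠ ∘ᶠ fstᶠ ,ᶠ sndᶠ ∘ᶠ fstᶠ ,ᶠ sndᶠ)) ∘ᶠ
  (idᶠ ,ᶠ indicesᶠ ∘ᶠ fstᶠ)

otherListᶠ : FP {mat ⊗ nat} {list nat} (λ (M , v) → otherList M v)
otherListᶠ = filterᶠ {P = mat ⊗ nat} {A = nat}
  (notᶠ (edgeᶠ ∘ᶠ (fstᶠ ∘ᶠ fstᶠ ,ᶠ sndᶠ ∘ᶠ fstᶠ ,ᶠ sndᶠ)) ∧ᶠ notᶠ (≡ᵇᶠ ∘ᶠ (sndᶠ ∘ᶠ fstᶠ ,ᶠ sndᶠ))) ∘ᶠ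
  (idᶠ ,ᶠ indicesᶠ ∘ᶠ fstᶠ)

nonPairsᶠ : FP {mat ⊗ list nat} {list (nat ⊗ nat)} (λ (M , xs) → nonPairs (edge M) xs)
nonPairsᶠ = ext (λ (M , xs) → eq M xs) (paraᶠ⁺ (space blockᶠ)
    (λ M a as ys → ≤-trans (weight-++ {nat ⊗ nat} (block (M , a , as)) ys) (+-monoˡ-≤ _ (grows blockᶠ (M , a , as))))
    []ᶠ (++ᶠ ∘ᶠ (blockᶠ ∘ᶠ (fstᶠ ,ᶠ secondᶠ ,ᶠ fstᶠ ∘ᶠ thirdᶠ) ,ᶠ sndᶠ ∘ᶠ thirdᶠ)))
  where
  block : List (List Bool) × ℕ × List ℕ → List (ℕ × ℕ)
  block (M , a , as) = map (a ,_) (filterᵇ (λ b → not (edge M a b)) as)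
  blockᶠ : FP {mat ⊗ nat ⊗ list nat} {list (nat ⊗ nat)} block
  blockᶠ = mapᶠ {P = nat} {A = nat} {B = nat ⊗ nat} idᶠ ∘ᶠ (secondᶠ ,ᶠ
    filterᶠ {P = mat ⊗ nat} {A = nat} (notᶠ (edgeᶠ ∘ᶠ (fstᶠ ∘ᶠ fstᶠ ,ᶠ sndᶠ ∘ᶠ fstᶠ ,ᶠ sndᶠ))) ∘ᶠ ((fstᶠ ,ᶠ secondᶠ) ,ᶠ thirdᶠ))
  eq : ∀ M xs → para (λ _ → []) (λ (M , a , as , ys) → block (M , a , as) ++ ys) M xs ≡ nonPairs (edge M) xs
  eq M [] = refl
  eq M (x ∷ xs) = cong (block (M , x , xs) ++_) (eq M xs)

labelListᶠ : FP {mat ⊗ nat} {list (nat ⊗ nat)} (λ (M , v) → labelList M v)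
labelListᶠ = ++ᶠ ∘ᶠ (mapᶠ {P = bool} {A = nat} {B = nat ⊗ nat} (sndᶠ ,ᶠ sndᶠ) ∘ᶠ (falseᶠ ,ᶠ otherListᶠ) ,ᶠ
  nonPairsᶠ ∘ᶠ (fstᶠ ,ᶠ neighbourListᶠ))

sizesᶠ : FP {mat ⊗ nat} {nat ⊗ nat}
  (λ (M , v) → length (neighbourList M v) , length (nonPairs (edge M) (neighbourList M v)))
sizesᶠ = lengthᶠ {nat} ∘ᶠ neighbourListᶠ ,ᶠ lengthᶠ {nat ⊗ nat} ∘ᶠ nonPairsᶠ ∘ᶠ (fstᶠ ,ᶠ neighbourListᶠ)

gainᶠ : FP {mat ⊗ nat} {nat} (λ (M , v) → gain M v)
gainᶠ = ∸ᶠ ∘ᶠ sizesᶠ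

reducibleᶠ : FP {mat ⊗ nat} {bool} (λ (M , v) → reducible M v)
reducibleᶠ = isZeroᶠ ∘ᶠ ∸ᶠ ∘ᶠ (sndᶠ ,ᶠ fstᶠ) ∘ᶠ sizesᶠ

linkᶠ : FP {(mat ⊗ nat) ⊗ (nat ⊗ nat) ⊗ (nat ⊗ nat)} {bool} (λ ((M , v) , l , m) → link (edge M) v l m)
linkᶠ = (E v a ∧ᶠ E v c ∧ᶠ notᶠ (≡ᵇᶠ ∘ᶠ (a ,ᶠ c))) ∨ᶠ E a c ∨ᶠ E a d ∨ᶠ E b c ∨ᶠ E b d
  where
  Context : Ty
  Context = (mat ⊗ nat) ⊗ (nat ⊗ nat) ⊗ (nat ⊗ nat)
  v : FP {Context} {nat} (λ ((_ , v) , _) → v)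
  v = sndᶠ ∘ᶠ fstᶠ
  a : FP {Context} {nat} (λ (_ , (a , _) , _) → a)
  a = fstᶠ ∘ᶠ secondᶠ
  b : FP {Context} {nat} (λ (_ , (_ , b) , _) → b)
  b = sndᶠ ∘ᶠ secondᶠ
  c : FP {Context} {nat} (λ (_ , _ , (c , _)) → c)
  c = fstᶠ ∘ᶠ thirdᶠ
  d : FP {Context} {nat} (λ (_ , _ , (_ , d)) → d)
  d = sndᶠ ∘ᶠ thirdᶠ
  E : {f g : ⟦ Context ⟧ → ℕ} → FP {Context} {nat} f → FP {Context} {nat} g →
    FP {Context} {bool} (λ s → edge (proj₁ (proj₁ s)) (f s) (g s))
  E F G = edgeᶠ ∘ᶠ (fstᶠ ∘ᶠ fstᶠ ,ᶠ F ,ᶠ G)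

structionMatrixᶠ : FP {mat ⊗ nat} {mat} (λ (M , v) → structionMatrix M v)
structionMatrixᶠ = mapᶠ {P = (mat ⊗ nat) ⊗ list (nat ⊗ nat)} {A = nat ⊗ nat} {B = list bool} rowᶠ ∘ᶠ
  ((idᶠ ,ᶠ labelListᶠ) ,ᶠ labelListᶠ)
  where
  rowᶠ : FP {((mat ⊗ nat) ⊗ list (nat ⊗ nat)) ⊗ (nat ⊗ nat)} {list bool}
    (λ (((M , v) , ms) , l) → map (link (edge M) v l) ms)
  rowᶠ = mapᶠ {P = (mat ⊗ nat) ⊗ (nat ⊗ nat)} {A = nat ⊗ nat} {B = bool}
    (linkᶠ ∘ᶠ (fstᶠ ∘ᶠ fstᶠ ,ᶠ sndᶠ ∘ᶠ fstᶠ ,ᶠ sndᶠ)) ∘ᶠ ((fstᶠ ∘ᶠ fstᶠ ,ᶠ sndᶠ) ,ᶠ sndᶠ ∘ᶠ fstᶠ)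

isEmptyᶠ : FP {list A} {bool} (λ xs → length xs ≡ᵇ 0)
isEmptyᶠ = isZeroᶠ ∘ᶠ lengthᶠ

weight-predDigits : ∀ ds → weight {list bool} (predDigits ds) ≤ weight {list bool} ds
weight-predDigits [] = ≤-refl
weight-predDigits (true ∷ ds) = ≤-refl
weight-predDigits (false ∷ []) = s≤s z≤n
weight-predDigits (false ∷ ds@(_ ∷ _)) = +-monoʳ-≤ 4 (weight-predDigits ds)

predDigitsᶠ : FP {list bool} {list bool} predDigits
predDigitsᶠ = ext eq (paraᶠ⁺ {P = bool} {A = bool} (con 3 ⊕ arg) le []ᶠ
    (ifᶠ secondᶠ (∷ᶠ ∘ᶠ (falseᶠ ,ᶠ fstᶠ ∘ᶠ thirdᶠ))
      (ifᶠ (isEmptyᶠ ∘ᶠ fstᶠ ∘ᶠ thirdᶠ) []ᶠ (∷ᶠ ∘ᶠ (trueᶠ ,ᶠ sndᶠ ∘ᶠ thirdᶠ)))) ∘ᶠ (falseᶠ ,ᶠ idᶠ))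
  where
  g : Bool × Bool × List Bool × List Bool → List Bool
  g (_ , d , ds , y) = when d then false ∷ ds else (when length ds ≡ᵇ 0 then [] else true ∷ y)
  eq : ∀ ds → para (λ _ → []) g false ds ≡ predDigits ds
  eq [] = refl
  eq (true ∷ ds) = refl
  eq (false ∷ []) = refl
  eq (false ∷ ds@(_ ∷ _)) = cong (true ∷_) (eq ds)
  le : ∀ p d ds y → weight {list bool} (g (p , d , ds , y)) ≤
    3 + weight {bool ⊗ bool ⊗ list bool} (p , d , ds) + weight {list bool} y
  le p true ds y = ≤-trans (m≤n+m (4 + weight {list bool} ds) 7) (m≤m+n _ _)
  le p false [] y = s≤s z≤n
  le p false (x ∷ ds) y = +-monoˡ-≤ (weight {list bool} y) {4} (s≤s (s≤s (s≤s (s≤s z≤n))))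

weight-decrement : ∀ k → weight {budgetTy} (decrement k) ≤ weight {budgetTy} k
weight-decrement (true , ds) = ≤-refl
weight-decrement (false , []) = ≤-refl
weight-decrement (false , ds@(_ ∷ _)) = +-monoʳ-≤ 4 (weight-predDigits ds)

decrementᶠ : FP {budgetTy} {budgetTy} decrement
decrementᶠ = ext eq (ifᶠ fstᶠ idᶠ (ifᶠ (isEmptyᶠ {bool} ∘ᶠ sndᶠ) (trueᶠ ,ᶠ []ᶠ) (falseᶠ ,ᶠ predDigitsᶠ ∘ᶠ sndᶠ)))
  where
  eq : ∀ ((neg , ds) : Bool × List Bool) →
    (when neg then (neg , ds) else (when length ds ≡ᵇ 0 then (true , []) else (false , predDigits ds))) ≡ decrement (neg , ds)
  eq (true , ds) = refl
  eq (false , ds) = refl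

stepᶠ : FP {mat ⊗ budgetTy} {mat ⊗ budgetTy} step
stepᶠ = ext (λ s@(M , k) → eq s (filterᵇ (reducible M) (indices M))) (caseᶠ {P = mat ⊗ budgetTy} {B = mat ⊗ budgetTy} {A = nat} idᶠ
    (structionMatrixᶠ ∘ᶠ (fstᶠ ∘ᶠ fstᶠ ,ᶠ secondᶠ) ,ᶠ
     foldᶠ weight-decrement decrementᶠ ∘ᶠ (sndᶠ ∘ᶠ fstᶠ ,ᶠ gainᶠ ∘ᶠ (fstᶠ ∘ᶠ fstᶠ ,ᶠ secondᶠ)))
  ∘ᶠ (idᶠ ,ᶠ filterᶠ {P = mat} {A = nat} reducibleᶠ ∘ᶠ (fstᶠ ,ᶠ indicesᶠ ∘ᶠ fstᶠ)))
  where
  eq : ∀ s vs → para (λ s → s) (λ (s , v , _) → reduceAt s v) s vs ≡ stepOn s vs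
  eq s [] = refl
  eq s (v ∷ vs) = refl

-- Growth of the state under iteration

square : Poly
square = con 1 ⊕ arg ⊛ (con 2 ⊕ arg ⊛ con 4)

-- An entry costs 3 and its cell 1; a row adds 1 for its end and 1 for its cell, the table 1 for its
-- end. `square` is the case of equal dimensions.
weight-table : ∀ {I : Set} (f : I → I → Bool) ls ms →
  weight {mat} (map (λ l → map (f l) ms) ls) ≡ 1 + length ls * (2 + length ms * 4)
weight-table f [] ms = refl
weight-table f (l ∷ ls) ms = begin
  suc (weight {list bool} (map (f l) ms) + weight {mat} (map (λ l → map (f l) ms) ls)) ≡⟨ cong₂ (λ a b → suc (a + b)) (row ms) (weight-table f ls ms) ⟩
  suc (suc (length ms * 4) + suc (length ls * (2 + length ms * 4))) ≡⟨ cong suc (cong suc (+-suc (length ms * 4) _)) ⟩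
  1 + length (l ∷ ls) * (2 + length ms * 4) ∎
  where
  open ≡-Reasoning
  row : ∀ ms → weight {list bool} (map (f l) ms) ≡ suc (length ms * 4)
  row [] = refl
  row (m ∷ ms) = cong (4 +_) (row ms)

length-neighbours-others : ∀ E vs v → length (neighbours E vs v) + length (others E vs v) ≤ length vs
length-neighbours-others E [] v = z≤n
length-neighbours-others E (x ∷ vs) v with E v x | v ≡ᵇ x
... | true  | _     = s≤s (length-neighbours-others E vs v)
... | false | true  = ≤-trans (length-neighbours-others E vs v) (n≤1+n _)
... | false | false = ≤-trans (≤-reflexive (+-suc _ _)) (s≤s (length-neighbours-others E vs v))

reducible⇒≤ : ∀ M v → T (reducible M v) →
  length (nonPairs (edge M) (neighbourList M v)) ≤ length (neighbourList M v)
reducible⇒≤ M v h = m∸n≡0⇒m≤n (≡ᵇ⇒≡ _ 0 h)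

length-labels : ∀ E vs v → length (labels E vs v) ≡ length (others E vs v) + length (nonPairs E (neighbours E vs v))
length-labels E vs v = trans (length-++ (map (λ o → o , o) (others E vs v))) (cong (_+ length (nonPairs E (neighbours E vs v))) (length-map _ (others E vs v)))

-- The `FP` bounds concern every input of the type, also ragged or asymmetric matrices. With a loop
-- at `v` no row need be lost, so the general bound is not strict; the strict loss for graphs is
-- `order-split`.
length-labelList : ∀ M v → T (reducible M v) → length (labelList M v) ≤ length M
length-labelList M v h = begin
  length (labelList M v)                                ≡⟨ length-labels (edge M) (indices M) v ⟩
  length (otherList M v) + _                            ≤⟨ +-monoʳ-≤ (length (otherList M v)) (reducible⇒≤ M v h) ⟩
  length (otherList M v) + length (neighbourList M v)   ≡⟨ +-comm (length (otherList M v)) _ ⟩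
  length (neighbourList M v) + length (otherList M v)   ≤⟨ length-neighbours-others (edge M) (indices M) v ⟩
  length (indices M)                                    ≡⟨ length-upTo (length M) ⟩
  length M                                              ∎
  where open ≤-Reasoning

data StepView (M : List (List Bool)) (k : Bool × List Bool) : State → Set where
  stuck  : (∀ {v} → v ∈ indices M → ¬ T (reducible M v)) → StepView M k (M , k)
  reduce : ∀ {v} → v ∈ indices M → T (reducible M v) → StepView M k (reduceAt (M , k) v)

stepView : ∀ M k → StepView M k (step (M , k))
stepView M k = go (filterᵇ (reducible M) (indices M))
    (λ v∈ → ∈-filter⁻ (λ v → T? (reducible M v)) v∈) (λ v∈ h → ∈-filter⁺ (λ v → T? (reducible M v)) v∈ h)
  where
  go : ∀ vs → (∀ {v} → v ∈ vs → v ∈ indices M × T (reducible M v)) →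
    (∀ {v} → v ∈ indices M → T (reducible M v) → v ∈ vs) → StepView M k (stepOn (M , k) vs)
  go [] _ complete = stuck λ v∈ h → case complete v∈ h of λ ()
  go (v ∷ vs) sound _ = let v∈ , h = sound (here refl) in reduce v∈ h

-- After a step the matrix is square with no more rows than the initial one, hence the summand
-- `square`. Before the first step it may have any row lengths, hence the initial weight. Both refer
-- to the fixed start `s`, so nothing accumulates.
record Bounded (s t : State) : Set where
  constructor bounds
  field
    rows   : length (proj₁ t) ≤ length (proj₁ s)
    matrix : weight {mat} (proj₁ t) ≤ weight {mat} (proj₁ s) + ⟪ square ⟫ (length (proj₁ s))
    budget : weight {budgetTy} (proj₂ t) ≤ weight {budgetTy} (proj₂ s)

weight-decrements : ∀ k n → weight {budgetTy} (fold k decrement n) ≤ weight {budgetTy} k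
weight-decrements k zero = ≤-refl
weight-decrements k (suc n) = ≤-trans (weight-decrement (fold k decrement n)) (weight-decrements k n)

step-bounded : ∀ s {t} → Bounded s t → Bounded s (step t)
step-bounded s {M , k} b@(bounds r m w) with step (M , k) | stepView M k
... | _ | stuck _ = b
... | _ | reduce {v} _ h = bounds
  (≤-trans (≤-reflexive (length-map _ (labelList M v))) labels≤)
  (≤-trans (≤-reflexive (weight-table (link (edge M) v) (labelList M v) (labelList M v)))
    (≤-trans (⟪⟫-mono square labels≤) (m≤n+m _ _)))
  (≤-trans (weight-decrements k (gain M v)) w)
  where
  labels≤ : length (labelList M v) ≤ length (proj₁ s)
  labels≤ = ≤-trans (length-labelList M v h) r

reduceStateᶠ : FP {mat ⊗ budgetTy} {mat ⊗ budgetTy} reduceState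
reduceStateᶠ = ext (λ s → eq s (proj₁ s))
  -- The rows of the input matrix act as the iteration counter, and the initial state is the
  -- parameter.
  (paraᶠ {A = list bool} (arg ⊕ square) weight≤ idᶠ (stepᶠ ∘ᶠ sndᶠ ∘ᶠ thirdᶠ) ∘ᶠ (idᶠ ,ᶠ fstᶠ))
  where
  iterated : State → List (List Bool) → State
  iterated = para (λ s → s) (λ (_ , _ , _ , t) → step t)
  eq : ∀ s xs → iterated s xs ≡ fold s step (length xs)
  eq s [] = refl
  eq s (_ ∷ xs) = cong step (eq s xs)
  iterated-bounded : ∀ s xs → Bounded s (iterated s xs)
  iterated-bounded s [] = bounds ≤-refl (m≤m+n _ _) ≤-refl
  iterated-bounded s (_ ∷ xs) = step-bounded s (iterated-bounded s xs)
  weight≤ : ∀ s xs → weight {mat ⊗ budgetTy} (iterated s xs) ≤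
    ⟪ arg ⊕ square ⟫ (weight {(mat ⊗ budgetTy) ⊗ list (list bool)} (s , xs))
  weight≤ s@(M , k) xs with iterated-bounded s xs
  ... | bounds _ m w = begin
    suc (weight {mat} (proj₁ t) + weight {budgetTy} (proj₂ t))  ≤⟨ s≤s (+-mono-≤ m w) ⟩
    suc (a + ⟪ square ⟫ (length M) + b)                         ≡⟨ cong suc (trans (+-assoc a _ b) (trans (cong (a +_) (+-comm _ b)) (sym (+-assoc a b _)))) ⟩
    suc (a + b) + ⟪ square ⟫ (length M)                         ≤⟨ +-mono-≤ s≤ (⟪⟫-mono square (≤-trans (length≤weight {list bool} M)
                                                                     (≤-trans (≤-trans (m≤m+n a b) (n≤1+n _)) s≤))) ⟩
    W + ⟪ square ⟫ W                                            ∎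
    where
    open ≤-Reasoning
    t = iterated s xs
    a = weight {mat} M
    b = weight {budgetTy} k
    W = weight {(mat ⊗ budgetTy) ⊗ list (list bool)} (s , xs)
    s≤ : suc (a + b) ≤ W
    s≤ = ≤-trans (m≤m+n (suc (a + b)) _) (n≤1+n _)

-- Codes of instances

matrixOf : Graph → List (List Bool)
matrixOf G = tabulate (λ u → tabulate (adj G u))

digits : ℕᵇ → List Bool
digits Bin.zero = []
digits 2[1+ x ] = true ∷ digits x
digits 1+[2 x ] = false ∷ digits x

budgetState : ℤ → Bool × List Bool
budgetState (⁺ i) = false , digits (fromℕ i)
budgetState -[1+ i ] = true , digits (fromℕ i)

state : Instance → State
state ⟨ G , k ⟩ = matrixOf G , budgetState k

code-digits : ∀ x → code {list bool} (digits x) ≡ encodeℕᵇ x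
code-digits Bin.zero = refl
code-digits 2[1+ x ] = cong (cons _) (code-digits x)
code-digits 1+[2 x ] = cong (cons _) (code-digits x)

code-state : ∀ I → code {mat ⊗ budgetTy} (state I) ≡ encodeInstance I
code-state ⟨ G , ⁺ i ⟩ = cong (λ c → cons (encodeGraph G) (cons nil c)) (code-digits (fromℕ i))
code-state ⟨ G , -[1+ i ] ⟩ = cong (λ c → cons (encodeGraph G) (cons (cons nil nil) c)) (code-digits (fromℕ i))

-- Decrementing the budget

decrementℤ : ℤ → ℤ
decrementℤ (⁺ zero) = -[1+ zero ]
decrementℤ (⁺ suc i) = ⁺ i
decrementℤ -[1+ i ] = -[1+ i ]

predDigits-digits : ∀ x → predDigits (digits x) ≡ digits (Bin.pred x)
predDigits-digits Bin.zero = refl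
predDigits-digits 2[1+ x ] = refl
predDigits-digits 1+[2 x ] = halve x
  where
  halve : ∀ x → predDigits (false ∷ digits x) ≡ digits (Bin.double x)
  halve Bin.zero = refl
  halve 2[1+ x ] = refl
  halve 1+[2 x ] = cong (true ∷_) (halve x)

decrement-budgetState : ∀ k → decrement (budgetState k) ≡ budgetState (decrementℤ k)
decrement-budgetState (⁺ zero) = refl
decrement-budgetState (⁺ suc i) with fromℕ (suc i) in eq
... | Bin.zero = case trans (sym (toℕᵇ-fromℕ (suc i))) (cong Bin.toℕ eq) of λ ()
... | x@(2[1+ _ ]) = cong (false ,_) (trans (predDigits-digits x) (cong digits (trans (cong Bin.pred (sym eq)) (sym (fromℕ-pred (suc i))))))
... | x@(1+[2 _ ]) = cong (false ,_) (trans (predDigits-digits x) (cong digits (trans (cong Bin.pred (sym eq)) (sym (fromℕ-pred (suc i))))))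
decrement-budgetState -[1+ i ] = refl

decrements-budgetState : ∀ k n → fold (budgetState k) decrement n ≡ budgetState (fold k decrementℤ n)
decrements-budgetState k zero = refl
decrements-budgetState k (suc n) = trans (cong decrement (decrements-budgetState k n)) (decrement-budgetState (fold k decrementℤ n))

decrementℤ-≤ : ∀ k → decrementℤ k ≤ℤ k
decrementℤ-≤ (⁺ zero) = -≤+
decrementℤ-≤ (⁺ suc i) = +≤+ (n≤1+n i)
decrementℤ-≤ -[1+ i ] = ℤ.≤-refl

decrementsℤ-≤ : ∀ k n → fold k decrementℤ n ≤ℤ k
decrementsℤ-≤ k zero = ℤ.≤-refl
decrementsℤ-≤ k (suc n) = ℤ.≤-trans (decrementℤ-≤ (fold k decrementℤ n)) (decrementsℤ-≤ k n)

-- Here and in the converse `decrements-≤`, stopping at a negative budget loses nothing: a cover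
-- size is never negative, so it fits no negative budget.
≤-decrements : ∀ k n {s} → ⁺ (s + n) ≤ℤ k → ⁺ s ≤ℤ fold k decrementℤ n
≤-decrements k zero {s} h = subst (λ m → ⁺ m ≤ℤ k) (+-identityʳ s) h
≤-decrements k (suc n) {s} h = below (fold k decrementℤ n) (≤-decrements k n (subst (λ m → ⁺ m ≤ℤ k) (+-suc s n) h))
  where
  below : ∀ k → ⁺ suc s ≤ℤ k → ⁺ s ≤ℤ decrementℤ k
  below (⁺ suc i) (+≤+ (s≤s s≤i)) = +≤+ s≤i

decrements-≤ : ∀ k n {s} → ⁺ s ≤ℤ fold k decrementℤ n → ⁺ (s + n) ≤ℤ k
decrements-≤ k zero {s} h = subst (λ m → ⁺ m ≤ℤ k) (sym (+-identityʳ s)) h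
decrements-≤ k (suc n) {s} h = subst (λ m → ⁺ m ≤ℤ k) (sym (+-suc s n)) (decrements-≤ k n (above (fold k decrementℤ n) h))
  where
  above : ∀ k → ⁺ s ≤ℤ decrementℤ k → ⁺ suc s ≤ℤ k
  above (⁺ suc i) (+≤+ s≤i) = +≤+ (s≤s s≤i)

-- Matrix entries and adjacency

headOr-drop-tabulate : ∀ {A : Set} (d : A) {n} (f : Fin n → A) i → headOr d (drop (toℕ i) (tabulate f)) ≡ f i
headOr-drop-tabulate d f zero = refl
headOr-drop-tabulate d f (suc i) = headOr-drop-tabulate d (λ i → f (suc i)) i

headOr-drop-default : ∀ {A : Set} (d : A) {n} (f : Fin n → A) x →
  (∃[ i ] toℕ {n} i ≡ x) ⊎ headOr d (drop x (tabulate f)) ≡ d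
headOr-drop-default d {zero} f zero = inj₂ refl
headOr-drop-default d {zero} f (suc x) = inj₂ refl
headOr-drop-default d {suc n} f zero = inj₁ (zero , refl)
headOr-drop-default d {suc n} f (suc x) with headOr-drop-default d (λ i → f (suc i)) x
... | inj₁ (i , eq) = inj₁ (suc i , cong suc eq)
... | inj₂ eq = inj₂ eq

upTo≡tabulate : ∀ n → upTo n ≡ tabulate {n = n} toℕ
upTo≡tabulate n = go (λ i → i) n
  where
  go : ∀ (f : ℕ → ℕ) n → applyUpTo f n ≡ tabulate {n = n} (λ i → f (toℕ i))
  go f zero = refl
  go f (suc n) = cong (f 0 ∷_) (go (λ i → f (suc i)) n)

module _ (G : Graph) where

  private
    E : ℕ → ℕ → Bool
    E = edge (matrixOf G)

  edge-adj : ∀ u v → E (toℕ u) (toℕ v) ≡ adj G u v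
  edge-adj u v = trans (cong (λ r → headOr false (drop (toℕ v) r)) (headOr-drop-tabulate [] _ u))
                       (headOr-drop-tabulate false (adj G u) v)

  -- Reading outside the matrix gives `false`, so only numbers of vertices carry edges. Symmetry and
  -- irreflexivity of the graph thereby extend to all numbers, as `Struction` demands.
  edge⇒adj : ∀ {x y} → T (E x y) → ∃[ u ] ∃[ v ] toℕ u ≡ x × toℕ v ≡ y × T (adj G u v)
  edge⇒adj {x} {y} h with headOr-drop-default [] {order G} (λ u → tabulate (adj G u)) x
  ... | inj₂ none = ⊥-elim (empty y (subst (λ r → T (headOr false (drop y r))) none h))
    where
    empty : ∀ y → ¬ T (headOr false (drop y []))
    empty zero ()
    empty (suc y) ()
  ... | inj₁ (u , eq) with headOr-drop-default false {order G} (adj G u) y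
    | subst (λ r → T (headOr false (drop y r)))
        (trans (cong (λ x → headOr [] (drop x (matrixOf G))) (sym eq)) (headOr-drop-tabulate [] (λ u → tabulate (adj G u)) u)) h
  ... | inj₂ none | k = ⊥-elim (subst T none k)
  ... | inj₁ (v , eq′) | k = u , v , eq , eq′ ,
    subst T (trans (cong (λ y → headOr false (drop y (tabulate (adj G u)))) (sym eq′)) (headOr-drop-tabulate false (adj G u) v)) k

  edge-sym : ∀ {x y} → T (E x y) → T (E y x)
  edge-sym {x} {y} h with edge⇒adj {x} {y} h
  ... | u , v , refl , refl , e = subst T (trans (Graph.symm G u v) (sym (edge-adj v u))) e

  edge-irrefl : ∀ x → ¬ T (E x x)
  edge-irrefl x h with edge⇒adj {x} {x} h
  ... | u , v , refl , eq , e with toℕ-injective eq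
  ... | refl = subst T (Graph.irrefl G u) e

  indices-matrixOf : indices (matrixOf G) ≡ tabulate toℕ
  indices-matrixOf = trans (cong upTo (length-tabulate (λ u → tabulate (adj G u)))) (upTo≡tabulate (order G))

  length-indices : length (indices (matrixOf G)) ≡ order G
  length-indices = trans (length-upTo _) (length-tabulate (λ u → tabulate (adj G u)))

  ∈-indices : ∀ v → toℕ v ∈ indices (matrixOf G)
  ∈-indices v = subst (toℕ v ∈_) (sym indices-matrixOf) (∈-tabulate⁺ v)

-- Covers and independent sets

∣∷∣ : ∀ {n} b (p : Subset n) → ∣ b ∷ p ∣ ≡ bit b + ∣ p ∣
∣∷∣ true p = refl
∣∷∣ false p = refl

∣tabulate∣ : ∀ {X : Set} {n} (f : Fin n → Bool) (p : X → Bool) (ℓ : Fin n → X) → (∀ i → f i ≡ p (ℓ i)) →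
  ∣ Vec.tabulate f ∣ ≡ count p (tabulate ℓ)
∣tabulate∣ {n = zero} f p ℓ h = refl
∣tabulate∣ {n = suc n} f p ℓ h = trans (∣∷∣ (f zero) (Vec.tabulate (λ i → f (suc i))))
  (cong₂ _+_ (cong bit (h zero)) (∣tabulate∣ (λ i → f (suc i)) p (λ i → ℓ (suc i)) (λ i → h (suc i))))

∈-tabulate : ∀ {n} {f : Fin n → Bool} {i} → T (f i) → i ∈ₛ Vec.tabulate f
∈-tabulate {f = f} {i} h = Vec.lookup⇒[]= i _ (trans (Vec.lookup∘tabulate f i) (T⇒≡true h))

tabulate-∈ : ∀ {n} {f : Fin n → Bool} {i} → i ∈ₛ Vec.tabulate f → T (f i)
tabulate-∈ {f = f} {i} h = subst T (sym (trans (sym (Vec.lookup∘tabulate f i)) (Vec.[]=⇒lookup h))) _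

module _ {X : Set} (G : Graph) (ℓ : V G → X) (E : X → X → Bool) (adj≡ : ∀ u v → adj G u v ≡ E (ℓ u) (ℓ v)) where

  cover : ∀ i → Independent E i → ∃[ S ] IsVertexCover G S × ∣ S ∣ + count i (tabulate ℓ) ≡ order G
  cover i ind = Vec.tabulate (λ u → not (i (ℓ u))) , covers , complement ℓ
    where
    covers : IsVertexCover G (Vec.tabulate (λ u → not (i (ℓ u))))
    covers u v e with T? (i (ℓ u)) | T? (i (ℓ v))
    ... | no ¬iu | _ = inj₁ (∈-tabulate (not-T ¬iu))
    ... | yes _ | no ¬iv = inj₂ (∈-tabulate (not-T ¬iv))
    ... | yes iu | yes iv = contradiction (subst T (adj≡ u v) e) (ind _ _ iu iv)
    complement : ∀ {n} (ℓ : Fin n → X) → ∣ Vec.tabulate (λ u → not (i (ℓ u))) ∣ + count i (tabulate ℓ) ≡ n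
    complement {zero} ℓ = refl
    complement {suc n} ℓ with i (ℓ zero) | complement (λ u → ℓ (suc u))
    ... | true  | ih = trans (+-suc _ _) (cong suc ih)
    ... | false | ih = cong suc ih

  module _ (_≟ₓ_ : (x y : X) → Dec (x ≡ y)) where

    -- A label is taken as soon as one vertex carrying it lies outside `S`. Covered vertices with
    -- the same label are then counted too, hence an inequality.
    uncovered : ∀ S → IsVertexCover G S → ∃[ i ] Independent E i × (∀ {x} → T (i x) → ∃[ u ] ℓ u ≡ x) ×
      order G ≤ count i (tabulate ℓ) + ∣ S ∣
    uncovered S covers = i , ind , (λ h → let u , eq , _ = toWitness h in u , eq) ,
        complement ℓ S λ u u∉ → fromWitness (u , refl , u∉)
      where
      outside? : ∀ x → Dec (∃[ u ] ℓ u ≡ x × ¬ (u ∈ₛ S))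
      outside? x = Fin.any? (λ u → (ℓ u ≟ₓ x) ×-dec ¬? (u ∈? S))
      i : X → Bool
      i x = ⌊ outside? x ⌋
      ind : Independent E i
      ind x y h k e with toWitness h | toWitness k
      ... | u , refl , u∉ | v , refl , v∉ with covers u v (subst T (sym (adj≡ u v)) e)
      ... | inj₁ u∈ = u∉ u∈
      ... | inj₂ v∈ = v∉ v∈
      complement : ∀ {n} (ℓ : Fin n → X) (S : Subset n) → (∀ u → ¬ (u ∈ₛ S) → T (i (ℓ u))) →
        n ≤ count i (tabulate ℓ) + ∣ S ∣
      complement ℓ [] h = z≤n
      complement ℓ (true ∷ S) h = ≤-trans (s≤s (complement _ S (λ u u∉ → h (suc u) (λ { (there u∈) → u∉ u∈ }))))
        (≤-trans (≤-reflexive (sym (+-suc _ _))) (+-monoˡ-≤ _ (m≤n+m _ (bit (i (ℓ zero))))))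
      complement ℓ (false ∷ S) h rewrite bit-T {i (ℓ zero)} (h zero λ ()) =
        s≤s (complement _ S (λ u u∉ → h (suc u) (λ { (there u∈) → u∉ u∈ })))

-- `Equivalent` is a disjunction, so two implications yield it only after deciding on which side the
-- instance lies.
yes? : ∀ I → Dec (YesInstance I)
yes? ⟨ G , k ⟩ = anySubset? (λ S →
  Fin.all? (λ u → Fin.all? (λ v → T? (adj G u v) →-dec ((u ∈? S) ⊎-dec (v ∈? S)))) ×-dec (⁺ ∣ S ∣ ℤ.≤? k))

-- Struction on instances

module _ (G : Graph) (v : ℕ) where

  private
    M = matrixOf G
    open module St = Struction (edge M) (λ {x} {y} → edge-sym G {x} {y}) (edge-irrefl G) using (link-sym)
    module At = St.At (indices M) v

  structionGraph : Graph
  structionGraph = record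
    { order  = length (labelList M v)
    ; adj    = λ i j → link (edge M) v (lookup (labelList M v) i) (lookup (labelList M v) j)
    ; symm   = λ i j → T-ext (link-sym v (lookup (labelList M v) i) (lookup (labelList M v) j))
                             (link-sym v (lookup (labelList M v) j) (lookup (labelList M v) i))
    ; irrefl = λ i → ¬T⇒false (At.link-irrefl (∈-lookup {xs = labelList M v} i))
    }
    where
    ¬T⇒false : ∀ {b} → ¬ T b → b ≡ false
    ¬T⇒false {false} _ = refl
    ¬T⇒false {true} h = contradiction _ h
    T-ext : ∀ {a b} → (T a → T b) → (T b → T a) → a ≡ b
    T-ext {false} _ g = sym (¬T⇒false g)
    T-ext {true} {true} _ _ = refl
    T-ext {true} {false} f _ = ⊥-elim (f _)

  matrixOf-structionGraph : matrixOf structionGraph ≡ structionMatrix M v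
  matrixOf-structionGraph = trans
    (tabulate-cong (λ i → tabulate∘lookup (link (edge M) v (lookup (labelList M v) i))))
    (tabulate∘lookup (λ l → map (link (edge M) v l) (labelList M v)))
    where
    tabulate∘lookup : ∀ {B : Set} (f : ℕ × ℕ → B) → tabulate (λ i → f (lookup (labelList M v) i)) ≡ map f (labelList M v)
    tabulate∘lookup f = trans (sym (map-tabulate (lookup (labelList M v)) f)) (cong (map f) (tabulate-lookup (labelList M v)))

  module _ (v∈ : v ∈ indices M) (red : T (reducible M v)) where

    private
      unique : Unique (indices M)
      unique = Unique.upTo⁺ (length M)

      p q : ℕ
      p = length (neighbourList M v)
      q = length (nonPairs (edge M) (neighbourList M v))

    -- Before the step there are `1 + p + |O|` vertices, afterwards `|O| + q`, and `q ≤ p` makes the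
    -- truncated difference exact.
    order-split : order G ≡ suc (order structionGraph + gain M v)
    order-split = begin
      order G                                           ≡⟨ length-indices G ⟨
      length (indices M)                                ≡⟨ At.length-split v∈ unique ⟩
      suc (p + length (otherList M v))                  ≡⟨ cong suc (+-comm p _) ⟩
      suc (length (otherList M v) + p)                  ≡⟨ cong (λ k → suc (length (otherList M v) + k)) (m+[n∸m]≡n (reducible⇒≤ M v red)) ⟨
      suc (length (otherList M v) + (q + (p ∸ q)))      ≡⟨ cong suc (+-assoc (length (otherList M v)) q _) ⟨
      suc (length (otherList M v) + q + (p ∸ q))        ≡⟨ cong (λ k → suc (k + (p ∸ q))) (length-labels (edge M) (indices M) v) ⟨
      suc (length (labelList M v) + (p ∸ q))            ∎
      where open ≡-Reasoning

    private
      L′ : tabulate (lookup (labelList M v)) ≡ labelList M v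
      L′ = tabulate-lookup (labelList M v)

    -- Complementing a cover gives an independent set, which loses at most one element under
    -- `forward`. As the order falls by one more than the gain, the complementary cover shrinks by
    -- at least the gain. `cover-backward` reverses this with `backward`.
    cover-forward : ∀ S → IsVertexCover G S →
      ∃[ S′ ] IsVertexCover structionGraph S′ × ∣ S′ ∣ + gain M v ≤ ∣ S ∣
    cover-forward S covers with uncovered G toℕ (edge M) (λ u w → sym (edge-adj G u w)) _≟_ S covers
    ... | i , ind , _ , n≤ with At.forward v∈ unique i ind
    ... | j , ind′ , i≤ with cover structionGraph (lookup (labelList M v)) (link (edge M) v) (λ _ _ → refl) j ind′
    ... | S′ , covers′ , eq = S′ , covers′ , +-cancelʳ-≤ (suc c) _ _ (begin
        ∣ S′ ∣ + d + suc c                ≡⟨ solve 3 (λ s d c → s :+ d :+ (con′ 1 :+ c) := con′ 1 :+ (s :+ c :+ d)) refl ∣ S′ ∣ d c ⟩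
        suc (∣ S′ ∣ + c + d)              ≡⟨ cong (λ ls → suc (∣ S′ ∣ + count j ls + d)) L′ ⟨
        suc (∣ S′ ∣ + count j (tabulate (lookup (labelList M v))) + d) ≡⟨ cong (λ k → suc (k + d)) eq ⟩
        suc (order structionGraph + d)    ≡⟨ order-split ⟨
        order G                           ≤⟨ n≤ ⟩
        count i (tabulate {n = order G} toℕ) + ∣ S ∣    ≡⟨ cong (λ xs → count i xs + ∣ S ∣) (indices-matrixOf G) ⟨
        count i (indices M) + ∣ S ∣       ≤⟨ +-monoˡ-≤ ∣ S ∣ i≤ ⟩
        suc c + ∣ S ∣                     ≡⟨ +-comm (suc c) ∣ S ∣ ⟩
        ∣ S ∣ + suc c                     ∎)
      where
      open ≤-Reasoning
      c = count j (labelList M v)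
      d = gain M v

    cover-backward : ∀ S′ → IsVertexCover structionGraph S′ →
      ∃[ S ] IsVertexCover G S × ∣ S ∣ ≤ ∣ S′ ∣ + gain M v
    cover-backward S′ covers′ with uncovered structionGraph (lookup (labelList M v)) (link (edge M) v) (λ _ _ → refl)
                                     (≡-dec _≟_ _≟_) S′ covers′
    ... | j , ind , support , n≤ with At.backward v∈ unique j ind
            (λ {l} jl → let u , eq = support jl in subst (_∈ labelList M v) eq (∈-lookup {xs = labelList M v} u))
    ... | i , ind′ , j≤ with cover G toℕ (edge M) (λ u w → sym (edge-adj G u w)) i ind′
    ... | S , covers , eq = S , covers , +-cancelʳ-≤ c _ _ (begin
        ∣ S ∣ + c                         ≡⟨ cong (λ xs → ∣ S ∣ + count i xs) (indices-matrixOf G) ⟩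
        ∣ S ∣ + count i (tabulate {n = order G} toℕ)    ≡⟨ eq ⟩
        order G                           ≡⟨ order-split ⟩
        suc (order structionGraph + d)    ≤⟨ s≤s (+-monoˡ-≤ d n≤) ⟩
        suc (count j (tabulate (lookup (labelList M v))) + ∣ S′ ∣ + d) ≡⟨ cong (λ ls → suc (count j ls + ∣ S′ ∣ + d)) L′ ⟩
        suc (count j (labelList M v) + ∣ S′ ∣ + d) ≡⟨ cong suc (+-assoc (count j (labelList M v)) _ d) ⟩
        suc (count j (labelList M v)) + (∣ S′ ∣ + d) ≤⟨ +-monoˡ-≤ _ j≤ ⟩
        c + (∣ S′ ∣ + d)                  ≡⟨ +-comm c _ ⟩
        ∣ S′ ∣ + d + c                    ∎)
      where
      open ≤-Reasoning
      c = count i (indices M)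
      d = gain M v

-- Iterating the struction

Final : Graph → Set
Final G = ∀ {v} → v ∈ indices (matrixOf G) → ¬ T (reducible (matrixOf G) v)

-- `computed` ties the instance to `n` steps of the compiled function. `progress` says that the
-- order has fallen by at least `n`, unless no reducible vertex is left.
record Reduct (I : Instance) (n : ℕ) : Set where
  field
    result   : Instance
    computed : state result ≡ fold (state I) step n
    yes⇒     : YesInstance I → YesInstance result
    yes⇐     : YesInstance result → YesInstance I
    budget≤  : budget result ≤ℤ budget I
    progress : order (graph result) + n ≤ order (graph I) ⊎ Final (graph result)

open Reduct

reducts : ∀ I n → Reduct I n
reducts I zero = record
  { result = I ; computed = refl ; yes⇒ = λ y → y ; yes⇐ = λ y → y ; budget≤ = ℤ.≤-refl
  ; progress = inj₁ (≤-reflexive (+-identityʳ _)) }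
reducts I (suc n) = next (reducts I n)
  where
  next : Reduct I n → Reduct I (suc n)
  next r@record { result = ⟨ G , k ⟩ } = go (stepView (matrixOf G) (budgetState k)) refl
    where
    go : ∀ {s} → StepView (matrixOf G) (budgetState k) s → step (matrixOf G , budgetState k) ≡ s → Reduct I (suc n)
    go (stuck none) eq = record
      { result = ⟨ G , k ⟩ ; computed = trans (sym eq) (cong step (computed r))
      ; yes⇒ = yes⇒ r ; yes⇐ = yes⇐ r ; budget≤ = budget≤ r ; progress = inj₂ none }
    go (reduce {v} v∈ red) eq = record
      { result = ⟨ G′ , k′ ⟩
      ; computed = trans (cong₂ _,_ (matrixOf-structionGraph G v) (sym (decrements-budgetState k d)))
                         (trans (sym eq) (cong step (computed r)))
      ; yes⇒ = λ y → forward (yes⇒ r y)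
      ; yes⇐ = λ y → yes⇐ r (backward y)
      ; budget≤ = ℤ.≤-trans (decrementsℤ-≤ k d) (budget≤ r)
      ; progress = inj₁ (smaller (progress r))
      }
      where
      G′ = structionGraph G v
      d = gain (matrixOf G) v
      k′ = fold k decrementℤ d
      forward : YesInstance ⟨ G , k ⟩ → YesInstance ⟨ G′ , k′ ⟩
      forward (S , covers , S≤) = let S′ , covers′ , le = cover-forward G v v∈ red S covers in
        S′ , covers′ , ≤-decrements k d (ℤ.≤-trans (+≤+ le) S≤)
      backward : YesInstance ⟨ G′ , k′ ⟩ → YesInstance ⟨ G , k ⟩
      backward (S′ , covers′ , S′≤) = let S , covers , le = cover-backward G v v∈ red S′ covers′ in
        S , covers , ℤ.≤-trans (+≤+ le) (decrements-≤ k d S′≤)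
      smaller : order G + n ≤ order (graph I) ⊎ Final G → order G′ + suc n ≤ order (graph I)
      smaller (inj₂ final) = contradiction red (final v∈)
      smaller (inj₁ le) = ≤-trans (≤-reflexive (+-suc (order G′) n))
        (≤-trans (+-monoˡ-≤ n (≤-trans (s≤s (m≤m+n _ d)) (≤-reflexive (sym (order-split G v v∈ red))))) le)

reduct : ∀ I → Reduct I (order (graph I))
reduct I = reducts I (order (graph I))

-- After as many steps as there were vertices, continued progress would leave the empty graph, which
-- has no vertex to reduce.
final : ∀ I → Final (graph (result (reduct I)))
final I {v} v∈ with progress (reduct I)
... | inj₂ f = f v∈
... | inj₁ le = λ _ → empty (subst (λ n → v ∈ upTo n) (trans (length-tabulate _) order≡0) v∈)
  where
  order≡0 : order (graph (result (reduct I))) ≡ 0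
  order≡0 = n≤0⇒n≡0 (+-cancelʳ-≤ (order (graph I)) _ 0 le)
  empty : ¬ (v ∈ [])
  empty ()

-- Neighbourhoods in the reduced graph

-- The number `n (n − 1) / 2` of unordered pairs, so indexed one lower than the usual triangular
-- numbers.
triangular : ℕ → ℕ
triangular zero = 0
triangular (suc n) = n + triangular n

module _ {A : Set} where

  count-cong : ∀ {p q : A → Bool} xs → (∀ x → p x ≡ q x) → count p xs ≡ count q xs
  count-cong [] h = refl
  count-cong (x ∷ xs) h = cong₂ (λ b n → bit b + n) (h x) (count-cong xs h)

  count-not : ∀ (p : A → Bool) xs → count p xs + count (λ x → not (p x)) xs ≡ length xs
  count-not p [] = refl
  count-not p (x ∷ xs) with p x
  ... | true  = cong suc (count-not p xs)
  ... | false = trans (+-suc _ _) (cong suc (count-not p xs))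

  filterᵇ-map : ∀ {B : Set} (p : B → Bool) (f : A → B) xs → filterᵇ p (map f xs) ≡ map f (filterᵇ (λ x → p (f x)) xs)
  filterᵇ-map p f [] = refl
  filterᵇ-map p f (x ∷ xs) with p (f x)
  ... | true  = cong (f x ∷_) (filterᵇ-map p f xs)
  ... | false = filterᵇ-map p f xs

  length-nonPairs-∷ : ∀ (E : A → A → Bool) x xs →
    length (nonPairs E (x ∷ xs)) ≡ count (λ y → not (E x y)) xs + length (nonPairs E xs)
  length-nonPairs-∷ E x xs = trans (length-++ (map (x ,_) ys)) (cong (_+ length (nonPairs E xs))
    (trans (length-map _ ys) (length-filterᵇ _ xs)))
    where ys = filterᵇ (λ y → not (E x y)) xs

  length-nonPairs-map : ∀ {B : Set} (E : B → B → Bool) (E′ : A → A → Bool) (f : A → B) →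
    (∀ x y → E (f x) (f y) ≡ E′ x y) → ∀ xs → length (nonPairs E (map f xs)) ≡ length (nonPairs E′ xs)
  length-nonPairs-map E E′ f h [] = refl
  length-nonPairs-map E E′ f h (x ∷ xs) = begin
    length (nonPairs E (map f (x ∷ xs)))                                          ≡⟨ length-nonPairs-∷′ ⟩
    count (λ y → not (E (f x) y)) (map f xs) + length (nonPairs E (map f xs))     ≡⟨ cong₂ _+_
      (trans (count-map _ f xs) (count-cong xs (λ y → cong not (h x y)))) (length-nonPairs-map E E′ f h xs) ⟩
    count (λ y → not (E′ x y)) xs + length (nonPairs E′ xs)                       ≡⟨ length-nonPairs-∷ E′ x xs ⟨
    length (nonPairs E′ (x ∷ xs))                                                 ∎
    where
    open ≡-Reasoning
    length-nonPairs-∷′ = trans (length-++ (map (f x ,_) (filterᵇ (λ y → not (E (f x) y)) (map f xs))))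
      (cong (_+ length (nonPairs E (map f xs))) (trans (length-map _ (filterᵇ (λ y → not (E (f x) y)) (map f xs)))
        (length-filterᵇ _ (map f xs))))

  length-filter : ∀ {P : A → Set} (P? : ∀ x → Dec (P x)) xs → length (filter P? xs) ≡ count (λ x → does (P? x)) xs
  length-filter P? [] = refl
  length-filter P? (x ∷ xs) with does (P? x)
  ... | true  = cong suc (length-filter P? xs)
  ... | false = length-filter P? xs

length-nonPairs≤triangular : ∀ {A : Set} (E : A → A → Bool) xs → length (nonPairs E xs) ≤ triangular (length xs)
length-nonPairs≤triangular E [] = z≤n
length-nonPairs≤triangular E (x ∷ xs) = ≤-trans (≤-reflexive (length-nonPairs-∷ E x xs))
  (+-mono-≤ (≤-trans (m≤n+m _ _) (≤-reflexive (count-not (E x) xs))) (length-nonPairs≤triangular E xs))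

-- The Boolean form of the filter in `edges`, which makes the number of edges a `count`.
increasing : ∀ {m} → (Fin m → Fin m → Bool) → Fin m × Fin m → Bool
increasing f (u , v) = does (u Fin.<? v) ∧ f u v

count-suc : ∀ {m} (p : Fin (suc m) → Bool) → count p (tabulate suc) ≡ count (λ j → p (suc j)) (allFin m)
count-suc {m} p = trans (cong (count p) (sym (map-tabulate {n = m} (λ i → i) suc))) (count-map p suc (allFin m))

-- Splits off row `zero`. Column `zero` contributes nothing because no index is below `zero`, and
-- the remaining entries form the same table one dimension smaller.
count-increasing : ∀ {m} (f : Fin (suc m) → Fin (suc m) → Bool) →
  count (increasing f) (cartesianProduct (allFin (suc m)) (allFin (suc m))) ≡
  count (λ j → f zero (suc j)) (allFin m) +
  count (increasing (λ i j → f (suc i) (suc j))) (cartesianProduct (allFin m) (allFin m))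
count-increasing {m} f = trans (count-++ (increasing f) (map (zero ,_) (allFin (suc m))) _) (cong₂ _+_
  (trans (count-map (increasing f) (zero ,_) (allFin (suc m))) (count-suc (λ j → increasing f (zero , j))))
  (trans (cong (λ us → count (increasing f) (cartesianProduct us (allFin (suc m)))) (sym (map-tabulate {n = m} (λ i → i) suc)))
    (rows (allFin m))))
  where
  rows : ∀ us → count (increasing f) (cartesianProduct (map suc us) (allFin (suc m))) ≡
    count (increasing (λ i j → f (suc i) (suc j))) (cartesianProduct us (allFin m))
  rows [] = refl
  rows (u ∷ us) = trans (count-++ (increasing f) (map (suc u ,_) (allFin (suc m))) _)
    (trans (cong₂ _+_
      (trans (count-map (increasing f) (suc u ,_) (allFin (suc m)))
        (trans (count-suc (λ j → increasing f (suc u , j)))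
          (sym (count-map (increasing (λ i j → f (suc i) (suc j))) (u ,_) (allFin m)))))
      (rows us))
    (sym (count-++ (increasing (λ i j → f (suc i) (suc j))) (map (u ,_) (allFin m)) _)))

module _ (G : Graph) where

  private
    M = matrixOf G

  -- Stated for lists to allow induction: a new head forms one pair with each later entry, counted
  -- as an edge in row `zero` or as a non-edge in the head's block of `nonPairs`.
  pairs-increasing : ∀ us →
    count (increasing (λ i j → adj G (lookup us i) (lookup us j))) (cartesianProduct (allFin (length us)) (allFin (length us)))
      + length (nonPairs (adj G) us) ≡ triangular (length us)
  pairs-increasing [] = refl
  pairs-increasing (u ∷ us) = begin
    count (increasing f) (cartesianProduct (allFin (length (u ∷ us))) (allFin (length (u ∷ us)))) + length (nonPairs (adj G) (u ∷ us))
      ≡⟨ cong₂ _+_ (count-increasing f) (length-nonPairs-∷ (adj G) u us) ⟩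
    (count (λ j → adj G u (lookup us j)) (allFin (length us)) + c) + (count (λ w → not (adj G u w)) us + length (nonPairs (adj G) us))
      ≡⟨ solve 4 (λ a b c d → (a :+ b) :+ (c :+ d) := (a :+ c) :+ (b :+ d)) refl
           (count (λ j → adj G u (lookup us j)) (allFin (length us))) c (count (λ w → not (adj G u w)) us) (length (nonPairs (adj G) us)) ⟩
    (count (λ j → adj G u (lookup us j)) (allFin (length us)) + count (λ w → not (adj G u w)) us) + (c + length (nonPairs (adj G) us))
      ≡⟨ cong₂ _+_ (cong (_+ count (λ w → not (adj G u w)) us) row) (pairs-increasing us) ⟩
    (count (adj G u) us + count (λ w → not (adj G u w)) us) + triangular (length us)
      ≡⟨ cong (_+ triangular (length us)) (count-not (adj G u) us) ⟩
    triangular (length (u ∷ us)) ∎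
    where
    open ≡-Reasoning
    f = λ i j → adj G (lookup (u ∷ us) i) (lookup (u ∷ us) j)
    c = count (increasing (λ i j → adj G (lookup us i) (lookup us j))) (cartesianProduct (allFin (length us)) (allFin (length us)))
    row : count (λ j → adj G u (lookup us j)) (allFin (length us)) ≡ count (adj G u) us
    row = trans (sym (count-map (adj G u) (lookup us) (allFin (length us))))
      (cong (count (adj G u)) (trans (map-tabulate (λ i → i) (lookup us)) (tabulate-lookup us)))

  edges+nonPairs : ∀ S → length (edges (inducedSubgraph G S)) + length (nonPairs (adj G) (elements S)) ≡ triangular (length (elements S))
  edges+nonPairs S = trans (cong (_+ length (nonPairs (adj G) (elements S))) (length-filter _ (cartesianProduct (allFin m) (allFin m))))
      (pairs-increasing (elements S))
    where m = length (elements S)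

  module _ (v : V G) where

    -- Both sides filter the vertices in increasing order, so they agree as lists; this carries the
    -- program's count of non-adjacent pairs over to the induced subgraph.
    neighbourList-elements : neighbourList M (toℕ v) ≡ map toℕ (elements (neighbourhood G v))
    neighbourList-elements = begin
      filterᵇ (edge M (toℕ v)) (indices M)                        ≡⟨ cong (filterᵇ (edge M (toℕ v))) (trans (indices-matrixOf G) (sym (map-tabulate (λ i → i) toℕ))) ⟩
      filterᵇ (edge M (toℕ v)) (map toℕ (allFin (order G)))       ≡⟨ filterᵇ-map (edge M (toℕ v)) toℕ (allFin (order G)) ⟩
      map toℕ (filterᵇ (λ u → edge M (toℕ v) (toℕ u)) (allFin (order G))) ≡⟨ cong (map toℕ) (filter-≐ _ (_∈? neighbourhood G v)
        ((λ {u} h → ∈-tabulate (subst T (edge-adj G v u) h)) , λ {u} h → subst T (sym (edge-adj G v u)) (tabulate-∈ h)) (allFin (order G))) ⟩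
      map toℕ (elements (neighbourhood G v))                      ∎
      where open ≡-Reasoning

    length-neighbourList : length (neighbourList M (toℕ v)) ≡ degree G v
    length-neighbourList = begin
      length (filterᵇ (edge M (toℕ v)) (indices M))   ≡⟨ length-filterᵇ _ (indices M) ⟩
      count (edge M (toℕ v)) (indices M)              ≡⟨ cong (count (edge M (toℕ v))) (indices-matrixOf G) ⟩
      count (edge M (toℕ v)) (tabulate {n = order G} toℕ)           ≡⟨ ∣tabulate∣ (adj G v) (edge M (toℕ v)) toℕ (λ u → sym (edge-adj G v u)) ⟨
      degree G v                                      ∎
      where open ≡-Reasoning

    length-elements : length (elements (neighbourhood G v)) ≡ degree G v
    length-elements = trans (sym (length-map toℕ (elements (neighbourhood G v))))
      (trans (cong length (sym neighbourList-elements)) length-neighbourList)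

    nonEdges : ℕ
    nonEdges = length (nonPairs (adj G) (elements (neighbourhood G v)))

    edges+nonEdges : length (edges (inducedSubgraph G (neighbourhood G v))) + nonEdges ≡ triangular (degree G v)
    edges+nonEdges = trans (edges+nonPairs (neighbourhood G v)) (cong triangular length-elements)

    nonEdges≤triangular : nonEdges ≤ triangular (degree G v)
    nonEdges≤triangular = ≤-trans (m≤n+m _ _) (≤-reflexive edges+nonEdges)

    nonPairs-elements : length (nonPairs (edge M) (neighbourList M (toℕ v))) ≡ nonEdges
    nonPairs-elements = trans (cong (λ xs → length (nonPairs (edge M) xs)) neighbourList-elements)
      (length-nonPairs-map (edge M) (adj G) toℕ (edge-adj G) (elements (neighbourhood G v)))

    degree<nonEdges : Final G → degree G v < nonEdges
    degree<nonEdges final = ≰⇒> λ le → final (∈-indices G v) (≡⇒≡ᵇ _ 0 (m≤n⇒m∸n≡0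
      (subst₂ _≤_ (sym nonPairs-elements) (sym length-neighbourList) le)))

    -- Fewer than four neighbours span at most as many pairs.
    4≤degree : Final G → 4 ≤ degree G v
    4≤degree final = ≰⇒> λ le → <-irrefl refl (≤-trans (degree<nonEdges final)
        (≤-trans nonEdges≤triangular (small le)))
      where
      small : ∀ {d} → d ≤ 3 → triangular d ≤ d
      small z≤n = z≤n
      small (s≤s z≤n) = z≤n
      small (s≤s (s≤s z≤n)) = s≤s z≤n
      small (s≤s (s≤s (s≤s z≤n))) = ≤-refl

    -- At least five of the six pairs of four neighbours are non-adjacent.
    fewEdges : Final G → degree G v ≡ 4 → length (edges (inducedSubgraph G (neighbourhood G v))) ≤ 2
    fewEdges final deg = ≤-trans (+-cancelʳ-≤ 5 _ 1 (≤-trans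
        (+-monoʳ-≤ _ (subst (_< nonEdges) deg (degree<nonEdges final)))
        (≤-reflexive (trans edges+nonEdges (cong triangular deg)))))
      (s≤s z≤n)

theorem5 :
  ∃[ reduce ] PolynomialTime encodeInstance encodeInstance reduce ×
    (∀ (I : Instance) →
      let G′ = graph (reduce I) in
      Equivalent I (reduce I)
      × budget (reduce I) ≤ℤ budget I
      × (∀ v → 4 ≤ degree G′ v)
      × (∀ v → degree G′ v ≡ 4 → length (edges (inducedSubgraph G′ (neighbourhood G′ v))) ≤ 2))
theorem5 = (λ I → result (reduct I)) ,
  polynomialTime {A = mat ⊗ budgetTy} {B = mat ⊗ budgetTy} {h = λ I → result (reduct I)} state state code-state code-state computes reduceStateᶠ ,
  λ I → equivalent I , budget≤ (reduct I) , (λ v → 4≤degree (graph (result (reduct I))) v (final I)) , (λ v → fewEdges (graph (result (reduct I))) v (final I))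
  where
  computes : ∀ I → reduceState (state I) ≡ state (result (reduct I))
  computes I@(⟨ G , k ⟩) = trans (cong (fold (state I) step) (length-tabulate (λ u → tabulate (adj G u)))) (sym (computed (reduct I)))
  equivalent : ∀ I → Equivalent I (result (reduct I))
  equivalent I with yes? I
  ... | yes y = inj₁ (y , yes⇒ (reduct I) y)
  ... | no n  = inj₂ (n , λ y → n (yes⇐ (reduct I) y))
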